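{- Consider the fair oblivious randomized protocol in which every informed node transmits the information $I$ at each time step (independently) with probability $p=\frac{\ln n}{n}$. For any integers $n>2$, $\alpha\ge0$, $\beta\ge 1$, any $V_{\max}>0$, and any $(\alpha,\beta)$-connected MANET of $n$ nodes (node speeds bounded by $V_{\max}$), this protocol solves the Dissemination problem in $$O\!\left(\alpha n+\left(1+\frac{\alpha}{\beta}\right)\frac{n^2}{\log n}\right)$$ time steps with probability at least $1-e^{ -(n-1)/4}$, where the constant hidden in $O(\cdot)$ is absolute.
   Context: **Model.** A MANET is a set $V$ of $n$ nodes in $\mathbb{R}^2$, no two at the same point at the same time. Time is divided into slots $1,2,\dots$; positions (hence topology) change only at slot boundaries, and no node moves faster than $V_{\max}$ (measured as distance per time slot). All nodes have the same range of transmission $r>0$; two nodes are neighbors in a slot if their distance is at most $r$ during the whole slot. An active node $u$ receives a transmission from a neighbor $v$ in a slot if and only if $v$ is the only node transmitting in that slot among $u$ and its neighbors. There is no collision detection. Nodes may be activated at any slot boundary, and may fail (become inactive) and be reactivated; upon activation a node starts its algorithm from scratch, keeping no state (so a node loses $I$ when it fails). **Dissemination problem.** Given a predicate $\mathcal{Q}$ on $V$ and a source node $s\in V$ that holds a piece of information $I$ at time $t_1$, distribute $I$ to all nodes of $\{x\in V:\mathcal{Q}(x)\}$. A node is covered if it has received $I$ (the source counts as covered from $t_1$), otherwise uncovered. A node is informed at time $t$ if it holds $I$ at time $t$. The problem is solved at slot $t_2\ge t_1$ if all target nodes are covered by slot $t_2$; time is counted from $t_1$. **$(\alpha,\beta)$-connectivity**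 (integers $\alpha\ge0$, $\beta\ge1$). For every slot $t\ge t_1$ at which the problem is not yet solved there is a slot $t'$ such that $[t,t+\alpha]\cap[t',t'+\beta)\neq\emptyset$, and there are nodes $p,p'$ such that at time $t'$ $p$ is informed and $p'$ is uncovered, and $p,p'$ are active and neighbors from step $t'$ until $p'$ becomes covered or until step $t'+\beta-1$ (inclusive), whichever occurs first. **Adversary.** Placement, movement and activation schedule are chosen by an adaptive adversary, which decides at the end of each slot with access to the protocol and all nodes' internal states but not to future random bits, subject to the speed bound and $(\alpha,\beta)$-connectivity. The theorem is for every such adversary; probability is over the protocol's random bits.
   Formalization: In (α,β)-connectivity, the slot common to [t,t+α] and [t',t'+β) must moreover be one before which p' was not yet covered; otherwise a contact that is already over counts until t'+β-1, and the bound fails for α=0, n=3 and large β. -}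

module Defs where

open import Algebra.Apartness.Bundles using (HeytingField)
open import Algebra.Bundles using (CommutativeRing; RawMonoid)
open import Data.Fin.Base using (Fin)
import Data.Fin.Properties as Fin
open import Data.Fin.Subset
  using (Subset; inside; outside; _∈_; _∉_; _∩_; _∪_; ⁅_⁆)
open import Data.Fin.Subset.Properties using (_∈?_)
open import Data.Nat.Base as ℕ using (ℕ; zero; suc; s≤s; z≤n)
open import Data.Product.Base using (Σ; Σ-syntax; ∃; ∃-syntax; _×_; _,_; proj₁; proj₂)
open import Data.Sum.Base using (_⊎_; inj₁; inj₂)
open import Data.Vec.Base using (Vec; []; _∷_; tabulate)
open import Function.Base using (_∘_)
open import Level using (Level; _⊔_) renaming (suc to lsuc)
open import Relation.Binary.Core using (Rel)
open import Relation.Binary.PropositionalEquality.Core using (_≡_; _≢_)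
open import Relation.Binary.Structures using (IsStrictPartialOrder)
open import Relation.Nullary.Decidable
  using (Dec; does; ¬?; _×-dec_; _⊎-dec_; _→-dec_)
open import Relation.Nullary.Negation using (¬_; contradiction)
open import Relation.Unary using (Pred; Decidable)
import Algebra.Definitions.RawMonoid as RawMonoidMultiplication
import Data.Bool.Base as Bool
import Algebra.Properties.Ring as RingProperties
import Relation.Binary.Reasoning.Setoid as SetoidReasoning

-- ℝ as the Cauchy-complete Archimedean ordered field, together with
-- square root, exponential and logarithm.  `complete` and `archimedean`
-- determine the field up to isomorphism, and the laws given for sqrt
-- (on x ≥ 0), exp and ln determine these functions uniquely.  The order
-- is not assumed decidable, so constructive models of ℝ are included
-- along with the classical one; hence _≤_ is the negation of _>_, and ln
-- takes a proof that its argument is positive.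

record Reals c ℓ₁ ℓ₂ : Set (lsuc (c ⊔ ℓ₁ ⊔ ℓ₂)) where
  field
    heytingField : HeytingField c ℓ₁ ℓ₂

  open HeytingField heytingField public

  +-rawMonoid : RawMonoid c ℓ₁
  +-rawMonoid = record { Carrier = Carrier ; _≈_ = _≈_ ; _∙_ = _+_ ; ε = 0# }

  open RawMonoidMultiplication +-rawMonoid using () renaming (_×_ to _·_)

  infix 4 _<_ _≤_

  field
    _<_                  : Rel Carrier ℓ₂
    isStrictPartialOrder : IsStrictPartialOrder _≈_ _<_
    #⇒<⊎>                : ∀ {x y} → x # y → x < y ⊎ y < x
    <⇒#                  : ∀ {x y} → x < y → x # y
    0<1                  : 0# < 1#
    +-monoˡ-<            : ∀ {x y} z → x < y → x + z < y + z
    *-pos                : ∀ {x y} → 0# < x → 0# < y → 0# < x * y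

  _≤_ : Rel Carrier ℓ₂
  x ≤ y = ¬ (y < x)

  fromℕ : ℕ → Carrier
  fromℕ n = n · 1#

  IsCauchy : (ℕ → Carrier) → Set (c ⊔ ℓ₂)
  IsCauchy f = ∀ ε → 0# < ε → Σ[ N ∈ ℕ ]
    (∀ i j → N ℕ.≤ i → N ℕ.≤ j → f i - f j < ε)

  _⟶_ : (ℕ → Carrier) → Carrier → Set (c ⊔ ℓ₂)
  f ⟶ l = ∀ ε → 0# < ε → Σ[ N ∈ ℕ ]
    (∀ i → N ℕ.≤ i → f i - l < ε × l - f i < ε)

  field
    archimedean : ∀ x → Σ[ n ∈ ℕ ] x < fromℕ n
    complete    : ∀ f → IsCauchy f → Σ[ l ∈ Carrier ] f ⟶ l

    sqrt        : Carrier → Carrier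
    sqrt-nonneg : ∀ {x} → 0# ≤ x → 0# ≤ sqrt x
    sqrt-square : ∀ {x} → 0# ≤ x → sqrt x * sqrt x ≈ x

    exp         : Carrier → Carrier
    exp-cong    : ∀ {x y} → x ≈ y → exp x ≈ exp y
    exp-0       : exp 0# ≈ 1#
    exp-+       : ∀ x y → exp (x + y) ≈ exp x * exp y
    1+x≤exp     : ∀ x → 1# + x ≤ exp x

    ln          : ∀ x → 0# < x → Carrier
    exp-ln      : ∀ {x} (x>0 : 0# < x) → exp (ln x x>0) ≈ x

module RealArithmetic {c ℓ₁ ℓ₂} (ℝ : Reals c ℓ₁ ℓ₂) where
  open Reals ℝ
  open IsStrictPartialOrder isStrictPartialOrder
    using (<-respʳ-≈; <-respˡ-≈; irrefl) renaming (trans to <-trans)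

  private
    commutativeRing : CommutativeRing c ℓ₁
    commutativeRing = record { isCommutativeRing = isCommutativeRing }
    open RingProperties (CommutativeRing.ring commutativeRing)
      using (-‿distribˡ-*)
    open SetoidReasoning (CommutativeRing.setoid commutativeRing)

    <-cotrans : ∀ {x y} → x < y → ∀ z → x < z ⊎ z < y
    <-cotrans x<y z with #-cotrans (<⇒# x<y) z
    ... | inj₁ x#z with #⇒<⊎> x#z
    ...   | inj₁ x<z = inj₁ x<z
    ...   | inj₂ z<x = inj₂ (<-trans z<x x<y)
    <-cotrans x<y z | inj₂ z#y with #⇒<⊎> z#y
    ...   | inj₁ z<y = inj₂ z<y
    ...   | inj₂ y<z = inj₁ (<-trans x<y y<z)

    x<y⇒0<y-x : ∀ {x y} → x < y → 0# < y - x
    x<y⇒0<y-x {x} x<y = <-respˡ-≈ (-‿inverseʳ x) (+-monoˡ-< (- x) x<y)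

    cancel : ∀ y x → (y - x) + x ≈ y
    cancel y x = begin
      (y - x) + x   ≈⟨ +-assoc y (- x) x ⟩
      y + (- x + x) ≈⟨ +-congˡ (-‿inverseˡ x) ⟩
      y + 0#        ≈⟨ +-identityʳ y ⟩
      y             ∎

    0<y-x⇒x<y : ∀ {x y} → 0# < y - x → x < y
    0<y-x⇒x<y {x} {y} 0<y-x =
      <-respˡ-≈ (+-identityˡ x) (<-respʳ-≈ (cancel y x) (+-monoˡ-< x 0<y-x))

    exp-l*exp-l≈1 : ∀ l → exp (- l) * exp l ≈ 1#
    exp-l*exp-l≈1 l = begin
      exp (- l) * exp l ≈⟨ exp-+ (- l) l ⟨
      exp (- l + l)     ≈⟨ exp-cong (-‿inverseˡ l) ⟩
      exp 0#            ≈⟨ exp-0 ⟩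
      1#                ∎

    1<x∧yx≈1⇒y<1 : ∀ {x y} → 1# < x → y * x ≈ 1# → y < 1#
    1<x∧yx≈1⇒y<1 {x} {y} 1<x yx≈1 with <-cotrans 0<1 y
    ... | inj₂ y<1 = y<1
    ... | inj₁ 0<y = 0<y-x⇒x<y (<-respʳ-≈ eq (*-pos 0<y (x<y⇒0<y-x 1<x)))
      where
      eq : y * (x - 1#) ≈ 1# - y
      eq = begin
        y * (x - 1#)         ≈⟨ distribˡ y x (- 1#) ⟩
        y * x + y * (- 1#)   ≈⟨ +-cong yx≈1 (*-comm y (- 1#)) ⟩
        1# + (- 1#) * y      ≈⟨ +-congˡ (-‿distribˡ-* 1# y) ⟨
        1# - (1# * y)        ≈⟨ +-congˡ (-‿cong (*-identityˡ y)) ⟩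
        1# - y               ∎

  1<exp⇒0< : ∀ {l} → 1# < exp l → 0# < l
  1<exp⇒0< {l} 1<el
    with <-cotrans (1<x∧yx≈1⇒y<1 1<el (exp-l*exp-l≈1 l)) (1# - l)
  ... | inj₁ e-l<1-l = contradiction e-l<1-l (1+x≤exp (- l))
  ... | inj₂ 1-l<1   = <-respʳ-≈ eq (x<y⇒0<y-x 1-l<1)
    where
    eq : 1# - (1# - l) ≈ l
    eq = begin
      1# - (1# - l)             ≈⟨ +-congʳ (cancel 1# l) ⟨
      ((1# - l) + l) - (1# - l) ≈⟨ +-congʳ (+-comm (1# - l) l) ⟩
      (l + (1# - l)) - (1# - l) ≈⟨ +-assoc l (1# - l) (- (1# - l)) ⟩
      l + ((1# - l) - (1# - l)) ≈⟨ +-congˡ (-‿inverseʳ (1# - l)) ⟩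
      l + 0#                    ≈⟨ +-identityʳ l ⟩
      l                         ∎

  x<1+x : ∀ x → x < 1# + x
  x<1+x x = <-respˡ-≈ (+-identityˡ x) (+-monoˡ-< x 0<1)

  0<fromℕ : ∀ {n} → 0 ℕ.< n → 0# < fromℕ n
  0<fromℕ {suc zero}    _ = x<1+x 0#
  0<fromℕ {suc (suc n)} _ = <-trans (0<fromℕ {suc n} (s≤s z≤n)) (x<1+x _)

  1<fromℕ : ∀ {n} → 1 ℕ.< n → 1# < fromℕ n
  1<fromℕ {suc n} (s≤s 0<n) =
    <-respˡ-≈ (+-identityˡ 1#)
      (<-respʳ-≈ (+-comm (fromℕ n) 1#) (+-monoˡ-< 1# (0<fromℕ 0<n)))

  ℝ⁺ : Set (c ⊔ ℓ₂)
  ℝ⁺ = Σ[ x ∈ Carrier ] 0# < x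

  infixl 7 _/_

  _/_ : Carrier → ℝ⁺ → Carrier
  x / (y , y>0) = x * proj₁ (#⇒invertible (#-sym (<⇒# y>0)))

  ⟦_⟧⁺ : (n : ℕ) → 0 ℕ.< n → ℝ⁺
  ⟦ n ⟧⁺ n>0 = fromℕ n , 0<fromℕ n>0

  ln⁺ : (n : ℕ) → 1 ℕ.< n → ℝ⁺
  ln⁺ n n>1 = ln (fromℕ n) n>0 , 1<exp⇒0< (<-respʳ-≈ (sym (exp-ln n>0)) (1<fromℕ n>1))
    where
    n>0 : 0# < fromℕ n
    n>0 = <-trans 0<1 (1<fromℕ n>1)

-- Slot k below is the k-th slot counted from t₁, so slot 0 is t₁ itself.
-- Nothing before t₁ matters: no node but the source can hold I then.

module Network {c ℓ₁ ℓ₂} (ℝ : Reals c ℓ₁ ℓ₂) (n : ℕ) where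
  open Reals ℝ
  open RealArithmetic ℝ

  Node : Set
  Node = Fin n

  Point : Set c
  Point = Carrier × Carrier

  dist : Point → Point → Carrier
  dist (x₁ , y₁) (x₂ , y₂) =
    sqrt ((x₁ - x₂) * (x₁ - x₂) + (y₁ - y₂) * (y₁ - y₂))

  -- What the adversary fixes for one slot.  Since ≤ on ℝ need not be
  -- decidable, the layout carries the decision of who is in range.
  record Layout (r : Carrier) : Set (c ⊔ ℓ₁ ⊔ ℓ₂) where
    field
      position : Node → Point
      distinct : ∀ {u v} → u ≢ v →
                 ¬ (proj₁ (position u) ≈ proj₁ (position v) ×
                    proj₂ (position u) ≈ proj₂ (position v))
      active   : Subset n
      inRange? : ∀ u v → Dec (dist (position u) (position v) ≤ r)

    Neighbors : Node → Node → Set ℓ₂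
    Neighbors u v = u ≢ v × dist (position u) (position v) ≤ r

    neighbors? : ∀ u v → Dec (Neighbors u v)
    neighbors? u v = ¬? (u Fin.≟ v) ×-dec inRange? u v

    -- u receives from v when exactly the nodes of `tx` transmit.
    Receives : Subset n → Node → Node → Set ℓ₂
    Receives tx u v = u ∈ active × Neighbors u v × v ∈ tx ×
      (∀ w → w ∈ tx → w ≡ u ⊎ Neighbors u w → w ≡ v)

    receives? : ∀ tx u v → Dec (Receives tx u v)
    receives? tx u v =
      (u ∈? active) ×-dec neighbors? u v ×-dec (v ∈? tx) ×-dec
      Fin.all? (λ w → (w ∈? tx) →-dec
        (((w Fin.≟ u) ⊎-dec neighbors? u w) →-dec (w Fin.≟ v)))

    receivers : Subset n → Subset n
    receivers tx = tabulate (λ u → does (Fin.any? (receives? tx u)))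

  -- One coin per node and slot; only the coins of informed nodes matter.
  Coins : Set
  Coins = Subset n

  -- The coins of the first k slots, most recent slot first.
  History : ℕ → Set
  History = Vec Coins

  -- An adaptive adversary.  The coins tossed so far determine all nodes'
  -- internal states, so a strategy may depend on them, but not on later
  -- coins.
  record Adversary (r Vmax : ℝ⁺) : Set (c ⊔ ℓ₁ ⊔ ℓ₂) where
    field
      layout : ∀ {k} → History k → Layout (proj₁ r)
      speed  : ∀ {k} (h : History k) (b : Coins) u →
               dist (Layout.position (layout h) u)
                    (Layout.position (layout (b ∷ h)) u) ≤ proj₁ Vmax

  module Execution {r Vmax : ℝ⁺} (A : Adversary r Vmax) (s : Node) where
    open Adversary A
    module At {k} (h : History k) = Layout (layout h)

    -- The state after history h, at the boundary before the next slot: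
    -- `held` is who left the previous slot holding I.  Nodes inactive in
    -- the coming slot lose I, which leaves the informed nodes of that slot.
    mutual
      held : ∀ {k} → History k → Subset n
      held []      = ⁅ s ⁆
      held (b ∷ h) = informed h ∪ received b h

      informed : ∀ {k} → History k → Subset n
      informed h = held h ∩ At.active h

      -- An informed node transmits iff its coin shows `inside`.
      received : ∀ {k} → Coins → History k → Subset n
      received b h = At.receivers h (informed h ∩ b)

    covered : ∀ {k} → History k → Subset n
    covered []      = ⁅ s ⁆
    covered (b ∷ h) = covered h ∪ received b h

    Solved : ∀ {q} → Pred Node q → ∀ {k} → History k → Set q
    Solved Q h = ∀ x → Q x → x ∈ covered h

    solved? : ∀ {q} {Q : Pred Node q} → Decidable Q →
              ∀ {k} (h : History k) → Dec (Solved Q h)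
    solved? Q? h = Fin.all? (λ x → Q? x →-dec (x ∈? covered h))

    prefix : (ℕ → Coins) → ∀ k → History k
    prefix ω zero    = []
    prefix ω (suc k) = ω k ∷ prefix ω k

    -- (p , p′) is a contact starting at slot t′: it lasts for the slots of
    -- [t′, t′+β) up to and including the one in which p′ becomes covered.
    record Contact (β : ℕ) (ω : ℕ → Coins) (t′ : ℕ) (p p′ : Node) : Set ℓ₂ where
      field
        informed-at-start  : p  ∈ informed (prefix ω t′)
        uncovered-at-start : p′ ∉ covered  (prefix ω t′)
        connected : ∀ y → t′ ℕ.≤ y → y ℕ.< t′ ℕ.+ β →
                    p′ ∉ covered (prefix ω y) →
                    p  ∈ At.active (prefix ω y) ×
                    p′ ∈ At.active (prefix ω y) ×
                    At.Neighbors (prefix ω y) p p′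

    -- (α,β)-connectivity.  The slot x common to [t, t+α] and the interval
    -- of the contact has to lie in the part that the contact actually
    -- lasts: p′ must not have been covered before x.  Otherwise a contact
    -- over by slot t would serve as witness until t′+β, the adversary could
    -- isolate the informed nodes for β-1 slots after each success, and no
    -- bound independent of the size of β would hold.
    Connected : ∀ {q} → Pred Node q → (α β : ℕ) → (ℕ → Coins) → Set (q ⊔ ℓ₂)
    Connected Q α β ω = ∀ t → ¬ Solved Q (prefix ω (suc t)) →
      ∃[ t′ ] ∃[ p ] ∃[ p′ ] Contact β ω t′ p p′ ×
      ∃[ x ] t ℕ.≤ x × x ℕ.≤ t ℕ.+ α × t′ ℕ.≤ x × x ℕ.< t′ ℕ.+ β ×
             p′ ∉ covered (prefix ω x)

  -- Probability when every coin independently shows `inside` with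
  -- probability p.
  module Probability (p : Carrier) where

    𝔼-coins : ∀ m → (Subset m → Carrier) → Carrier
    𝔼-coins zero    f = f []
    𝔼-coins (suc m) f = p        * 𝔼-coins m (f ∘ (inside  ∷_))
                      + (1# - p) * 𝔼-coins m (f ∘ (outside ∷_))

    𝔼 : ∀ k → (History k → Carrier) → Carrier
    𝔼 zero    f = f []
    𝔼 (suc k) f = 𝔼 k (λ h → 𝔼-coins n (λ b → f (b ∷ h)))

    Pr : ∀ k {e} {E : Pred (History k) e} → Decidable E → Carrier
    Pr k E? = 𝔼 k (λ h → Bool.if does (E? h) then 1# else 0#)

{-# OPTIONS --safe #-}
-- Call a slot linked if some informed node is then a neighbour of an active
-- uncovered one.  In a linked slot that uncovered node has some d ≥ 1 informed
-- neighbours, and exactly one of them transmits with probability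
-- d p (1 - p)ᵈ⁻¹ ≥ p / K, for an absolute constant K: the extremes d = 1 and
-- d = n are the worst, and (1 - p)ⁿ is of order 1 / n.  So with rate = p / 2K
-- the process exp (rate · #links) · e^(-#covered) is a supermartingale.
-- Connectivity forces ≥ M ~ n² / ln n linked slots on an unsolved execution of
-- length αn + (1 + α/β) M, where the process is at least eⁿ; Markov's inequality
-- bounds the probability of that by e⁻ⁿ.
module Submission where

open import Algebra.Bundles using (CommutativeRing)
open import Data.Bool.Base as Bool using (Bool; true; false; not; if_then_else_)
open import Data.Empty using (⊥-elim)
open import Data.Fin.Base using (Fin; zero; suc)
import Data.Fin.Properties as Fin
open import Data.Fin.Subset
  using (Subset; inside; outside; _∈_; _∉_; _⊆_; _∩_; _∪_; ⁅_⁆; ∣_∣)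
open import Data.Fin.Subset.Properties
open import Data.Nat.Base as ℕ using (ℕ; zero; suc; z≤n; s≤s; _≡ᵇ_)
open import Data.Nat.DivMod using (m≡m%n+[m/n]*n; m%n<n; m/n*n≤m)
open import Data.Nat.Properties as ℕ using (<-trans; n<1+n)
import Data.Nat.Solver as ℕSolver
open import Data.Product.Base using (Σ-syntax; ∃-syntax; _×_; _,_; proj₁; proj₂)
open import Data.Sum.Base using (_⊎_; inj₁; inj₂; [_,_]′)
open import Data.Vec.Base using ([]; _∷_; tabulate; here; there)
open import Data.Vec.Properties using (lookup∘tabulate; []=⇒lookup; lookup⇒[]=)
open import Defs
open import Function.Base using (_∘_; id; case_of_)
open import Relation.Binary.Bundles using (Preorder)
open import Relation.Binary.PropositionalEquality.Core as ≡ using (_≡_; _≢_)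
open import Relation.Binary.Structures using (IsStrictPartialOrder)
open import Relation.Nullary.Decidable
  using (Dec; yes; no; does; dec-true; dec-false; _×-dec_; ¬?)
open import Relation.Nullary.Negation using (¬_; contradiction)
open import Relation.Unary using (Pred; Decidable)

-- Chance and connectivity meet only in the number of linked slots. The one-slot estimate holds for
-- every layout that may follow a history, so adaptivity costs nothing. Connectivity is used on one
-- coin sequence at a time and is pure counting in ℕ. The choice p = ln n / n balances the two
-- extremes: a lone informed neighbor succeeds with probability p, while n of them give n p (1 -
-- p)ⁿ⁻¹, again of order p because (1 - p)ⁿ is of order 1 / n. The covered nodes take a factor of up
-- to eⁿ away from the process, so the links have to contribute e²ⁿ to leave eⁿ. This asks for M ·
-- rate ≥ 2n, hence M of about 4K n² / ln n. In the time bound a covered node accounts for α slots,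
-- which gives the term αn, and a link for 1 + α/β slots. As the order on the reals is not decided,
-- `≤` is a negation: case distinctions are made by cotransitivity or inside a proof by
-- contradiction.

-- Ordered-field arithmetic over an undecided order.

module OrderedField {c ℓ₁ ℓ₂} (ℝ : Reals c ℓ₁ ℓ₂) where
  open Reals ℝ
  open RealArithmetic ℝ
  open IsStrictPartialOrder isStrictPartialOrder public
    using (<-respʳ-≈; <-respˡ-≈) renaming (trans to <-trans′; irrefl to <-irrefl)

  commutativeRing : CommutativeRing c ℓ₁
  commutativeRing = record { isCommutativeRing = isCommutativeRing }

  open CommutativeRing commutativeRing public
    using (commutativeSemiring; semiring)
  open import Algebra.Apartness.Properties.HeytingCommutativeRing
    heytingCommutativeRing using (invertibleˡ⇒#; x-0≈x)
  open import Algebra.Properties.Semiring.Exp semiring public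
    using (_^_; ^-homo-*; ^-congˡ)
  open import Algebra.Properties.Semiring.Mult semiring public
    using (×1-homo-*; ×-homo-+)
  open import Algebra.Solver.Ring.NaturalCoefficients.Default commutativeSemiring public
    using (solve; _:=_; _:+_; _:*_; con)

  module ≈-Reasoning where
    open import Relation.Binary.Reasoning.Setoid (CommutativeRing.setoid commutativeRing) public

  private variable x y z u v : Carrier

  <-cotrans : x < y → ∀ z → x < z ⊎ z < y
  <-cotrans x<y z with #-cotrans (<⇒# x<y) z
  ... | inj₁ x#z with #⇒<⊎> x#z
  ...   | inj₁ x<z = inj₁ x<z
  ...   | inj₂ z<x = inj₂ (<-trans′ z<x x<y)
  <-cotrans x<y z | inj₂ z#y with #⇒<⊎> z#y
  ...   | inj₁ z<y = inj₂ z<y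
  ...   | inj₂ y<z = inj₁ (<-trans′ x<y y<z)

  ≤-reflexive : x ≈ y → x ≤ y
  ≤-reflexive x≈y = <-irrefl (sym x≈y)

  ≤-refl : x ≤ x
  ≤-refl = ≤-reflexive refl

  <⇒≤ : x < y → x ≤ y
  <⇒≤ x<y y<x = <-irrefl refl (<-trans′ x<y y<x)

  -- A supposed `z < x` splits at `y` by cotransitivity, and each half contradicts one hypothesis.
  ≤-trans : x ≤ y → y ≤ z → x ≤ z
  ≤-trans {y = y} x≤y y≤z z<x = [ y≤z , x≤y ]′ (<-cotrans z<x y)

  <-≤-trans : x < y → y ≤ z → x < z
  <-≤-trans {z = z} x<y y≤z = [ id , ⊥-elim ∘ y≤z ]′ (<-cotrans x<y z)

  ≤-<-trans : x ≤ y → y < z → x < z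
  ≤-<-trans {x = x} x≤y y<z = [ ⊥-elim ∘ x≤y , id ]′ (<-cotrans y<z x)

  ≤-preorder : Preorder c ℓ₁ ℓ₂
  ≤-preorder = record
    { _≲_ = _≤_
    ; isPreorder = record
      { isEquivalence = isEquivalence ; reflexive = ≤-reflexive ; trans = ≤-trans } }

  module ≤-Reasoning where
    open import Relation.Binary.Reasoning.Preorder ≤-preorder public

  private
    cancelʳ : ∀ x z → x + z - z ≈ x
    cancelʳ x z = begin
      x + z - z   ≈⟨ +-assoc x z (- z) ⟩
      x + (z - z) ≈⟨ +-congˡ (-‿inverseʳ z) ⟩
      x + 0#      ≈⟨ +-identityʳ x ⟩
      x           ∎
      where open ≈-Reasoning

    cancelʳ′ : ∀ x z → x - z + z ≈ x
    cancelʳ′ x z = begin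
      x - z + z     ≈⟨ +-assoc x (- z) z ⟩
      x + (- z + z) ≈⟨ +-congˡ (-‿inverseˡ z) ⟩
      x + 0#        ≈⟨ +-identityʳ x ⟩
      x             ∎
      where open ≈-Reasoning

  +-cancelʳ-< : ∀ z → x + z < y + z → x < y
  +-cancelʳ-< {x} {y} z lt =
    <-respˡ-≈ (cancelʳ x z) (<-respʳ-≈ (cancelʳ y z) (+-monoˡ-< (- z) lt))

  +-monoˡ-≤ : ∀ z → x ≤ y → x + z ≤ y + z
  +-monoˡ-≤ z x≤y = x≤y ∘ +-cancelʳ-< z

  +-cancelʳ-≤ : ∀ z → x + z ≤ y + z → x ≤ y
  +-cancelʳ-≤ z x+z≤y+z = x+z≤y+z ∘ +-monoˡ-< z

  +-mono-≤ : x ≤ y → u ≤ v → x + u ≤ y + v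
  +-mono-≤ {x} {y} {u} {v} x≤y u≤v = ≤-trans (+-monoˡ-≤ u x≤y)
    (≤-trans (≤-reflexive (+-comm y u)) (≤-trans (+-monoˡ-≤ y u≤v) (≤-reflexive (+-comm v y))))

  x≤x+y : 0# ≤ y → x ≤ x + y
  x≤x+y {x = x} 0≤y = ≤-trans (≤-reflexive (sym (+-identityʳ x))) (+-mono-≤ ≤-refl 0≤y)

  x≤y+x : 0# ≤ y → x ≤ y + x
  x≤y+x {y} {x} 0≤y = ≤-trans (x≤x+y 0≤y) (≤-reflexive (+-comm x y))

  +-nonneg : 0# ≤ x → 0# ≤ y → 0# ≤ x + y
  +-nonneg 0≤x 0≤y = ≤-trans 0≤x (x≤x+y 0≤y)

  x≤y⇒0≤y-x : x ≤ y → 0# ≤ y - x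
  x≤y⇒0≤y-x {x} {y} x≤y = +-cancelʳ-≤ x
    (≤-trans (≤-reflexive (+-identityˡ x)) (≤-trans x≤y (≤-reflexive (sym (cancelʳ′ y x)))))

  x<y⇒0<y-x : x < y → 0# < y - x
  x<y⇒0<y-x {x} x<y = <-respˡ-≈ (-‿inverseʳ x) (+-monoˡ-< (- x) x<y)

  x+[y-x]≈y : ∀ x y → x + (y - x) ≈ y
  x+[y-x]≈y x y = trans (+-comm x (y - x)) (cancelʳ′ y x)

  private
    split : ∀ z x y → z * (x - y) + z * y ≈ z * x
    split z x y = trans (sym (distribˡ z (x - y) y)) (*-congˡ (cancelʳ′ x y))

  *-monoˡ-< : 0# < z → x < y → z * x < z * y
  *-monoˡ-< {z} {x} {y} 0<z x<y =
    <-respˡ-≈ (+-identityˡ (z * x))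
      (<-respʳ-≈ (split z y x) (+-monoˡ-< (z * x) (*-pos 0<z (x<y⇒0<y-x x<y))))

  *-cancelˡ-≤ : 0# < z → z * x ≤ z * y → x ≤ y
  *-cancelˡ-≤ 0<z zx≤zy = zx≤zy ∘ *-monoˡ-< 0<z

  -- An invertible product has invertible factors, which decides the signs.
  *-monoˡ-≤ : 0# ≤ z → x ≤ y → z * x ≤ z * y
  *-monoˡ-≤ {z} {x} {y} 0≤z x≤y zy<zx =
    case #⇒invertible (<⇒# zy<zx) of λ { (w , w*≈1 , _) →
    [ (λ z<0 → 0≤z z<0)
    , (λ 0<z → [ x≤y , (λ x<y → <⇒≤ (*-monoˡ-< 0<z x<y) zy<zx) ]′
                 (#⇒<⊎> (invertibleˡ⇒# (w * z , trans (*-assoc w z _) (trans (*-congˡ diff) w*≈1)))))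
    ]′ (#⇒<⊎> (invertibleˡ⇒# (w * (y - x) , (begin
         w * (y - x) * (z - 0#) ≈⟨ *-congˡ (x-0≈x z) ⟩
         w * (y - x) * z        ≈⟨ *-assoc w (y - x) z ⟩
         w * ((y - x) * z)      ≈⟨ *-congˡ (*-comm (y - x) z) ⟩
         w * (z * (y - x))      ≈⟨ *-congˡ diff ⟩
         w * (z * y - z * x)    ≈⟨ w*≈1 ⟩
         1#                     ∎)))) }
    where
    open ≈-Reasoning
    diff : z * (y - x) ≈ z * y - z * x
    diff = begin
      z * (y - x)                   ≈⟨ cancelʳ _ (z * x) ⟨
      z * (y - x) + z * x - z * x   ≈⟨ +-congʳ (split z y x) ⟩
      z * y - z * x                 ∎

  *-nonneg : 0# ≤ x → 0# ≤ y → 0# ≤ x * y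
  *-nonneg {x} 0≤x 0≤y = ≤-trans (≤-reflexive (sym (zeroʳ x))) (*-monoˡ-≤ 0≤x 0≤y)

  *-monoʳ-≤ : 0# ≤ z → x ≤ y → x * z ≤ y * z
  *-monoʳ-≤ {z} {x} {y} 0≤z x≤y =
    ≤-trans (≤-reflexive (*-comm x z)) (≤-trans (*-monoˡ-≤ 0≤z x≤y) (≤-reflexive (*-comm z y)))

  *-mono-≤ : 0# ≤ x → 0# ≤ v → x ≤ y → u ≤ v → x * u ≤ y * v
  *-mono-≤ 0≤x 0≤v x≤y u≤v = ≤-trans (*-monoˡ-≤ 0≤x u≤v) (*-monoʳ-≤ 0≤v x≤y)

  0≤1 : 0# ≤ 1#
  0≤1 = <⇒≤ 0<1

  ^-nonneg : 0# ≤ x → ∀ k → 0# ≤ x ^ k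
  ^-nonneg 0≤x zero    = 0≤1
  ^-nonneg 0≤x (suc k) = *-nonneg 0≤x (^-nonneg 0≤x k)

  ^-mono-≤ : 0# ≤ x → x ≤ y → ∀ k → x ^ k ≤ y ^ k
  ^-mono-≤ 0≤x x≤y zero    = ≤-refl
  ^-mono-≤ 0≤x x≤y (suc k) = *-mono-≤ 0≤x (^-nonneg (≤-trans 0≤x x≤y) k) x≤y (^-mono-≤ 0≤x x≤y k)

  1≤^ : 1# ≤ x → ∀ k → 1# ≤ x ^ k
  1≤^ 1≤x zero    = ≤-refl
  1≤^ {x} 1≤x (suc k) = ≤-trans (≤-reflexive (sym (*-identityˡ 1#)))
    (*-mono-≤ 0≤1 (≤-trans 0≤1 (1≤^ 1≤x k)) 1≤x (1≤^ 1≤x k))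

  ^-monoʳ-≤ : 1# ≤ x → ∀ {j k} → j ℕ.≤ k → x ^ j ≤ x ^ k
  ^-monoʳ-≤ 1≤x {k = k} z≤n = 1≤^ 1≤x k
  ^-monoʳ-≤ 1≤x (s≤s j≤k) = *-monoˡ-≤ (≤-trans 0≤1 1≤x) (^-monoʳ-≤ 1≤x j≤k)

  ^-antimonoʳ-≤ : 0# ≤ x → x ≤ 1# → ∀ {j k} → j ℕ.≤ k → x ^ k ≤ x ^ j
  ^-antimonoʳ-≤ 0≤x x≤1 {k = zero}  z≤n = ≤-refl
  ^-antimonoʳ-≤ {x} 0≤x x≤1 {k = suc k} z≤n = ≤-trans
    (*-mono-≤ 0≤x 0≤1 x≤1 (^-antimonoʳ-≤ 0≤x x≤1 {k = k} z≤n)) (≤-reflexive (*-identityˡ 1#))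
  ^-antimonoʳ-≤ 0≤x x≤1 (s≤s j≤k) = *-monoˡ-≤ 0≤x (^-antimonoʳ-≤ 0≤x x≤1 j≤k)

  1^k≈1 : ∀ k → 1# ^ k ≈ 1#
  1^k≈1 zero    = refl
  1^k≈1 (suc k) = trans (*-identityˡ _) (1^k≈1 k)

  ^-distrib-* : ∀ x y k → (x * y) ^ k ≈ x ^ k * y ^ k
  ^-distrib-* x y zero    = sym (*-identityˡ 1#)
  ^-distrib-* x y (suc k) = trans (*-congˡ (^-distrib-* x y k))
    (solve 4 (λ a b c d → (a :* b) :* (c :* d) := (a :* c) :* (b :* d)) refl x y (x ^ k) (y ^ k))

  0≤fromℕ : ∀ k → 0# ≤ fromℕ k
  0≤fromℕ zero    = ≤-refl
  0≤fromℕ (suc k) = +-nonneg 0≤1 (0≤fromℕ k)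

  fromℕ-mono-≤ : ∀ {j k} → j ℕ.≤ k → fromℕ j ≤ fromℕ k
  fromℕ-mono-≤ {k = k} z≤n = 0≤fromℕ k
  fromℕ-mono-≤ (s≤s j≤k)   = +-mono-≤ ≤-refl (fromℕ-mono-≤ j≤k)

  fromℕ-+ : ∀ j k → fromℕ (j ℕ.+ k) ≈ fromℕ j + fromℕ k
  fromℕ-+ = ×-homo-+ 1#

  fromℕ-* : ∀ j k → fromℕ (j ℕ.* k) ≈ fromℕ j * fromℕ k
  fromℕ-* = ×1-homo-*

  1≤fromℕ : ∀ {k} → 1 ℕ.≤ k → 1# ≤ fromℕ k
  1≤fromℕ 1≤k = ≤-trans (≤-reflexive (sym (+-identityʳ 1#))) (fromℕ-mono-≤ 1≤k)

  /-cancel : ∀ x (y⁺ : ℝ⁺) → x / y⁺ * proj₁ y⁺ ≈ x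
  /-cancel x (y , 0<y) = begin
    x * y⁻¹ * y          ≈⟨ *-assoc x y⁻¹ y ⟩
    x * (y⁻¹ * y)        ≈⟨ *-congˡ (*-congˡ (x-0≈x y)) ⟨
    x * (y⁻¹ * (y - 0#)) ≈⟨ *-congˡ (proj₁ (proj₂ (#⇒invertible (#-sym (<⇒# 0<y))))) ⟩
    x * 1#               ≈⟨ *-identityʳ x ⟩
    x                    ∎
    where
    open ≈-Reasoning
    y⁻¹ : Carrier
    y⁻¹ = proj₁ (#⇒invertible (#-sym (<⇒# 0<y)))

  /-nonneg : ∀ (y⁺ : ℝ⁺) → 0# ≤ x → 0# ≤ x / y⁺
  /-nonneg {x} (y , 0<y) 0≤x = *-cancelˡ-≤ 0<y (begin
    y * 0#            ≈⟨ zeroʳ y ⟩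
    0#                ≲⟨ 0≤x ⟩
    x                 ≈⟨ /-cancel x (y , 0<y) ⟨
    x / (y , 0<y) * y ≈⟨ *-comm _ y ⟩
    y * (x / (y , 0<y)) ∎)
    where open ≤-Reasoning

  -- Strict comparison being undecidable, the ceiling is only approximate.
  ceiling : ∀ x → 0# ≤ x → Σ[ m ∈ ℕ ] x ≤ fromℕ m × fromℕ m ≤ 1# + (1# + x)
  ceiling x 0≤x = let N , x<N = archimedean x in search N (<⇒≤ x<N)
    where
    search : ∀ N → x ≤ fromℕ N → Σ[ m ∈ ℕ ] x ≤ fromℕ m × fromℕ m ≤ 1# + (1# + x)
    search zero    x≤0   = 0 , x≤0 , +-nonneg 0≤1 (+-nonneg 0≤1 0≤x)
    search (suc N) x≤1+N with <-cotrans (x<1+x (fromℕ N)) (1# + x)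
    ... | inj₁ N<1+x   = suc N , x≤1+N , +-mono-≤ ≤-refl (<⇒≤ N<1+x)
    ... | inj₂ 1+x<1+N = search N
      (+-cancelʳ-≤ 1# (≤-trans (≤-reflexive (+-comm x 1#))
        (≤-trans (<⇒≤ 1+x<1+N) (≤-reflexive (+-comm 1# (fromℕ N))))))

-- The exponential function, from `1 + x ≤ exp x` and the addition law.

module Exponential {c ℓ₁ ℓ₂} (ℝ : Reals c ℓ₁ ℓ₂) where
  open Reals ℝ
  open OrderedField ℝ

  private variable x y : Carrier

  exp-inverse : ∀ x → exp (- x) * exp x ≈ 1#
  exp-inverse x = trans (sym (exp-+ (- x) x)) (trans (exp-cong (-‿inverseˡ x)) exp-0)

  1≤exp : 0# ≤ x → 1# ≤ exp x
  1≤exp 0≤x = ≤-trans (x≤x+y 0≤x) (1+x≤exp _)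

  0≤exp : 0# ≤ x → 0# ≤ exp x
  0≤exp 0≤x = ≤-trans 0≤1 (1≤exp 0≤x)

  0<exp : 0# ≤ x → 0# < exp x
  0<exp 0≤x = <-≤-trans 0<1 (1≤exp 0≤x)

  0≤exp-neg : 0# ≤ x → 0# ≤ exp (- x)
  0≤exp-neg {x} 0≤x = *-cancelˡ-≤ (0<exp 0≤x) (begin
    exp x * 0#        ≈⟨ zeroʳ (exp x) ⟩
    0#                ≲⟨ 0≤1 ⟩
    1#                ≈⟨ exp-inverse x ⟨
    exp (- x) * exp x ≈⟨ *-comm _ _ ⟩
    exp x * exp (- x) ∎)
    where open ≤-Reasoning

  exp-mono-≤ : 0# ≤ x → x ≤ y → exp x ≤ exp y
  exp-mono-≤ {x} {y} 0≤x x≤y = begin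
    exp x               ≈⟨ *-identityʳ (exp x) ⟨
    exp x * 1#          ≲⟨ *-monoˡ-≤ (0≤exp 0≤x) (1≤exp (x≤y⇒0≤y-x x≤y)) ⟩
    exp x * exp (y - x) ≈⟨ exp-+ x (y - x) ⟨
    exp (x + (y - x))   ≈⟨ exp-cong (x+[y-x]≈y x y) ⟩
    exp y               ∎
    where open ≤-Reasoning

  exp-fromℕ : ∀ k x → exp (fromℕ k * x) ≈ exp x ^ k
  exp-fromℕ zero    x = trans (exp-cong (zeroˡ x)) exp-0
  exp-fromℕ (suc k) x = begin
    exp ((1# + fromℕ k) * x)    ≈⟨ exp-cong (trans (distribʳ x 1# (fromℕ k)) (+-congʳ (*-identityˡ x))) ⟩
    exp (x + fromℕ k * x)       ≈⟨ exp-+ x (fromℕ k * x) ⟩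
    exp x * exp (fromℕ k * x)   ≈⟨ *-congˡ (exp-fromℕ k x) ⟩
    exp x * exp x ^ k           ∎
    where open ≈-Reasoning

  -- From `y ≤ 1 - x ≤ exp (- x)`. It gives both the decay of the powers of 1 - p and the one-slot
  -- decrease of the supermartingale.
  complement-*-exp : x + y ≤ 1# → 0# ≤ x → y * exp x ≤ 1#
  complement-*-exp {x} {y} x+y≤1 0≤x = begin
    y * exp x         ≲⟨ *-monoʳ-≤ (0≤exp 0≤x) (≤-trans y≤1-x (1+x≤exp (- x))) ⟩
    exp (- x) * exp x ≈⟨ exp-inverse x ⟩
    1#                ∎
    where
    open ≤-Reasoning
    y≤1-x : y ≤ 1# - x
    y≤1-x = +-cancelʳ-≤ x (begin
      y + x        ≈⟨ +-comm y x ⟩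
      x + y        ≲⟨ x+y≤1 ⟩
      1#           ≈⟨ x+[y-x]≈y x 1# ⟨
      x + (1# - x) ≈⟨ +-comm x _ ⟩
      1# - x + x   ∎)

  e⁻¹ : Carrier
  e⁻¹ = exp (- 1#)

  0≤e⁻¹ : 0# ≤ e⁻¹
  0≤e⁻¹ = 0≤exp-neg 0≤1

  -- That is e ≥ 2. Covering a node thus at least halves the process, which is why `rate` may be
  -- half of the isolation probability.
  e⁻¹+e⁻¹≤1 : e⁻¹ + e⁻¹ ≤ 1#
  e⁻¹+e⁻¹≤1 = begin
    e⁻¹ + e⁻¹       ≈⟨ solve 1 (λ z → z :+ z := z :* con 2) refl e⁻¹ ⟩
    e⁻¹ * (1# + 1#) ≲⟨ *-monoˡ-≤ 0≤e⁻¹ (1+x≤exp 1#) ⟩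
    e⁻¹ * exp 1#    ≈⟨ exp-inverse 1# ⟩
    1#              ∎
    where open ≤-Reasoning

  e⁻¹≤1 : e⁻¹ ≤ 1#
  e⁻¹≤1 = ≤-trans (x≤x+y 0≤e⁻¹) e⁻¹+e⁻¹≤1

  e⁻¹^n*e^n≈1 : ∀ n → e⁻¹ ^ n * exp 1# ^ n ≈ 1#
  e⁻¹^n*e^n≈1 n = trans (sym (^-distrib-* e⁻¹ (exp 1#) n))
    (trans (^-congˡ n (exp-inverse 1#)) (1^k≈1 n))

-- The bounds 1 / (K n) ≤ yⁿ ≤ 1 / n, interpolated by weighted AM-GM, give
-- (d + 1) yᵈ ≥ 1 / K for all d ≤ n.  For the lower one take u = ℓ / (n - ℓ):
-- then y eᵘ ≥ 1, and n u = ℓ + ℓ² / (n - ℓ) ≤ ℓ + 4 since (1 + ℓ/2)² ≤ e^ℓ = n.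
module LogarithmicRate {c ℓ₁ ℓ₂} (ℝ : Reals c ℓ₁ ℓ₂)
  (n : ℕ) (n>1 : 1 ℕ.< n) (n>0 : 0 ℕ.< n) where
  open Reals ℝ
  open RealArithmetic ℝ
  open OrderedField ℝ
  open Exponential ℝ

  ν ℓ p y : Carrier
  ν = fromℕ n
  ℓ = proj₁ (ln⁺ n n>1)
  p = ℓ / ⟦ n ⟧⁺ n>0
  y = 1# - p

  0<ν : 0# < ν
  0<ν = 0<fromℕ n>0

  0≤ν : 0# ≤ ν
  0≤ν = <⇒≤ 0<ν

  0≤ℓ : 0# ≤ ℓ
  0≤ℓ = <⇒≤ (proj₂ (ln⁺ n n>1))

  exp-ℓ : exp ℓ ≈ ν
  exp-ℓ = exp-ln _

  1+ℓ≤ν : 1# + ℓ ≤ ν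
  1+ℓ≤ν = ≤-trans (1+x≤exp ℓ) (≤-reflexive exp-ℓ)

  p*ν≈ℓ : p * ν ≈ ℓ
  p*ν≈ℓ = /-cancel ℓ (⟦ n ⟧⁺ n>0)

  p+y≈1 : p + y ≈ 1#
  p+y≈1 = x+[y-x]≈y p 1#

  0≤p : 0# ≤ p
  0≤p = /-nonneg (⟦ n ⟧⁺ n>0) 0≤ℓ

  private
    ν*y+ℓ≈ν : ν * y + ℓ ≈ ν
    ν*y+ℓ≈ν = begin
      ν * y + ℓ     ≈⟨ +-congˡ p*ν≈ℓ ⟨
      ν * y + p * ν ≈⟨ solve 3 (λ ν y p → ν :* y :+ p :* ν := ν :* (p :+ y)) refl ν y p ⟩
      ν * (p + y)   ≈⟨ *-congˡ p+y≈1 ⟩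
      ν * 1#        ≈⟨ *-identityʳ ν ⟩
      ν             ∎
      where open ≈-Reasoning

    1≤ν*y : 1# ≤ ν * y
    1≤ν*y = +-cancelʳ-≤ ℓ (≤-trans 1+ℓ≤ν (≤-reflexive (sym ν*y+ℓ≈ν)))

    0<ν*y : 0# < ν * y
    0<ν*y = <-≤-trans 0<1 1≤ν*y

  0≤y : 0# ≤ y
  0≤y = *-cancelˡ-≤ 0<ν (≤-trans (≤-reflexive (zeroʳ ν)) (<⇒≤ 0<ν*y))

  y≤1 : y ≤ 1#
  y≤1 = ≤-trans (x≤y+x 0≤p) (≤-reflexive p+y≈1)

  private
    h : Carrier
    h = ℓ / ⟦ 2 ⟧⁺ (s≤s z≤n)

    h+h≈ℓ : h + h ≈ ℓ
    h+h≈ℓ = trans (solve 1 (λ h → h :+ h := h :* (con 1 :+ (con 1 :+ con 0))) refl h)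
      (/-cancel ℓ (⟦ 2 ⟧⁺ (s≤s z≤n)))

    0≤h : 0# ≤ h
    0≤h = /-nonneg (⟦ 2 ⟧⁺ (s≤s z≤n)) 0≤ℓ

    -- Here `ν * y` is n - ℓ, and `(1 + h)²` expands to 1 + ℓ + h², so that (1 + ℓ/2)² ≤ n leaves h²
    -- ≤ n - ℓ once the 1 is dropped.
    h*h≤ν*y : h * h ≤ ν * y
    h*h≤ν*y = +-cancelʳ-≤ ℓ (begin
      h * h + ℓ                 ≲⟨ x≤y+x 0≤1 ⟩
      1# + (h * h + ℓ)          ≈⟨ +-congˡ (+-congˡ h+h≈ℓ) ⟨
      1# + (h * h + (h + h))    ≈⟨ solve 1 (λ h → con 1 :+ (h :* h :+ (h :+ h)) := (con 1 :+ h) :* (con 1 :+ h)) refl h ⟩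
      (1# + h) * (1# + h)       ≲⟨ *-mono-≤ (+-nonneg 0≤1 0≤h) (0≤exp 0≤h) (1+x≤exp h) (1+x≤exp h) ⟩
      exp h * exp h             ≈⟨ exp-+ h h ⟨
      exp (h + h)               ≈⟨ exp-cong h+h≈ℓ ⟩
      exp ℓ                     ≈⟨ exp-ℓ ⟩
      ν                         ≈⟨ ν*y+ℓ≈ν ⟨
      ν * y + ℓ                 ∎)
      where open ≤-Reasoning

    ℓ*ℓ≤4*ν*y : ℓ * ℓ ≤ fromℕ 4 * (ν * y)
    ℓ*ℓ≤4*ν*y = begin
      ℓ * ℓ             ≈⟨ *-cong h+h≈ℓ h+h≈ℓ ⟨
      (h + h) * (h + h) ≈⟨ solve 1 (λ h → (h :+ h) :* (h :+ h) := (con 1 :+ (con 1 :+ (con 1 :+ (con 1 :+ con 0)))) :* (h :* h)) refl h ⟩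
      fromℕ 4 * (h * h) ≲⟨ *-monoˡ-≤ (0≤fromℕ 4) h*h≤ν*y ⟩
      fromℕ 4 * (ν * y) ∎
      where open ≤-Reasoning

    u : Carrier
    u = ℓ / (ν * y , 0<ν*y)

    u*ν*y≈ℓ : u * (ν * y) ≈ ℓ
    u*ν*y≈ℓ = /-cancel ℓ (ν * y , 0<ν*y)

    0≤u : 0# ≤ u
    0≤u = /-nonneg (ν * y , 0<ν*y) 0≤ℓ

    -- The choice of `u` makes `y * (1 + u)` exactly 1, since n y u = ℓ = n - n y.
    1≤y*exp-u : 1# ≤ y * exp u
    1≤y*exp-u = *-cancelˡ-≤ 0<ν (begin
      ν * 1#              ≈⟨ *-identityʳ ν ⟩
      ν                   ≈⟨ ν*y+ℓ≈ν ⟨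
      ν * y + ℓ           ≈⟨ +-congˡ u*ν*y≈ℓ ⟨
      ν * y + u * (ν * y) ≈⟨ solve 3 (λ ν y u → ν :* y :+ u :* (ν :* y) := ν :* (y :* (con 1 :+ u))) refl ν y u ⟩
      ν * (y * (1# + u))  ≲⟨ *-monoˡ-≤ 0≤ν (*-monoˡ-≤ 0≤y (1+x≤exp u)) ⟩
      ν * (y * exp u)     ∎)
      where open ≤-Reasoning

    ν*u≤ℓ+4 : ν * u ≤ ℓ + fromℕ 4
    ν*u≤ℓ+4 = begin
      ν * u               ≈⟨ *-congʳ ν*y+ℓ≈ν ⟨
      (ν * y + ℓ) * u     ≈⟨ solve 4 (λ ν y ℓ u → (ν :* y :+ ℓ) :* u := u :* (ν :* y) :+ ℓ :* u) refl ν y ℓ u ⟩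
      u * (ν * y) + ℓ * u ≈⟨ +-congʳ u*ν*y≈ℓ ⟩
      ℓ + ℓ * u           ≲⟨ +-mono-≤ ≤-refl (*-cancelˡ-≤ 0<ν*y (begin
        ν * y * (ℓ * u)     ≈⟨ solve 4 (λ ν y ℓ u → ν :* y :* (ℓ :* u) := ℓ :* (u :* (ν :* y))) refl ν y ℓ u ⟩
        ℓ * (u * (ν * y))   ≈⟨ *-congˡ u*ν*y≈ℓ ⟩
        ℓ * ℓ               ≲⟨ ℓ*ℓ≤4*ν*y ⟩
        fromℕ 4 * (ν * y)   ≈⟨ *-comm _ _ ⟩
        ν * y * fromℕ 4     ∎)) ⟩
      ℓ + fromℕ 4         ∎
      where open ≤-Reasoning

  1≤y^n*ν*K : ∀ {K} → exp (fromℕ 4) ≤ K → 1# ≤ y ^ n * (ν * K)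
  1≤y^n*ν*K {K} e⁴≤K = begin
    1#                                 ≲⟨ 1≤^ 1≤y*exp-u n ⟩
    (y * exp u) ^ n                    ≈⟨ ^-distrib-* y (exp u) n ⟩
    y ^ n * exp u ^ n                  ≈⟨ *-congˡ (exp-fromℕ n u) ⟨
    y ^ n * exp (ν * u)                ≲⟨ *-monoˡ-≤ (^-nonneg 0≤y n) (exp-mono-≤ (*-nonneg 0≤ν 0≤u) ν*u≤ℓ+4) ⟩
    y ^ n * exp (ℓ + fromℕ 4)          ≈⟨ *-congˡ (exp-+ ℓ (fromℕ 4)) ⟩
    y ^ n * (exp ℓ * exp (fromℕ 4))    ≈⟨ *-congˡ (*-congʳ exp-ℓ) ⟩
    y ^ n * (ν * exp (fromℕ 4))        ≲⟨ *-monoˡ-≤ (^-nonneg 0≤y n) (*-monoˡ-≤ 0≤ν e⁴≤K) ⟩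
    y ^ n * (ν * K)                    ∎
    where open ≤-Reasoning

  y^m*exp≤1 : ∀ m → y ^ m * exp (fromℕ m * p) ≤ 1#
  y^m*exp≤1 m = begin
    y ^ m * exp (fromℕ m * p) ≈⟨ *-congˡ (exp-fromℕ m p) ⟩
    y ^ m * exp p ^ m         ≈⟨ ^-distrib-* y (exp p) m ⟨
    (y * exp p) ^ m           ≲⟨ ^-mono-≤ (*-nonneg 0≤y (0≤exp 0≤p)) (complement-*-exp (≤-reflexive p+y≈1) 0≤p) m ⟩
    1# ^ m                    ≈⟨ 1^k≈1 m ⟩
    1#                        ∎
    where open ≤-Reasoning

  y^n*ν≤1 : y ^ n * ν ≤ 1#
  y^n*ν≤1 = ≤-trans
    (≤-reflexive (*-congˡ (sym (trans (exp-cong (trans (*-comm ν p) p*ν≈ℓ)) exp-ℓ)))) (y^m*exp≤1 n)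

  -- The weights j and m on the numbers 1 and `y ^ (j + m)` have weighted geometric mean `y ^ m`.
  -- Induction on j avoids roots: writing the old power as its p-part plus its y-part, the step
  -- reduces to `small`, which follows from `y ^ m * (1 + m p) ≤ y ^ m * exp (m p) ≤ 1`.
  weighted-AM-GM : ∀ m j → fromℕ (j ℕ.+ m) * y ^ m ≤ fromℕ j + fromℕ m * y ^ (j ℕ.+ m)
  weighted-AM-GM m zero    = x≤y+x ≤-refl
  weighted-AM-GM m (suc j) = begin
    (1# + fromℕ (j ℕ.+ m)) * y ^ m
      ≈⟨ solve 2 (λ a b → (con 1 :+ a) :* b := a :* b :+ b) refl (fromℕ (j ℕ.+ m)) (y ^ m) ⟩
    fromℕ (j ℕ.+ m) * y ^ m + y ^ m
      ≲⟨ +-mono-≤ (weighted-AM-GM m j) ≤-refl ⟩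
    fromℕ j + fromℕ m * Y + y ^ m
      ≈⟨ +-congʳ (+-congˡ (trans (sym (*-identityʳ _)) (*-congˡ (sym p+y≈1)))) ⟩
    fromℕ j + fromℕ m * Y * (p + y) + y ^ m
      ≈⟨ solve 6 (λ j m Y p y z → j :+ m :* Y :* (p :+ y) :+ z := (z :+ m :* p :* Y) :+ (j :+ m :* (y :* Y))) refl (fromℕ j) (fromℕ m) Y p y (y ^ m) ⟩
    (y ^ m + fromℕ m * p * Y) + (fromℕ j + fromℕ m * (y * Y))
      ≲⟨ +-mono-≤ small ≤-refl ⟩
    1# + (fromℕ j + fromℕ m * (y * Y))
      ≈⟨ +-assoc _ _ _ ⟨
    1# + fromℕ j + fromℕ m * (y * Y) ∎
    where
    open ≤-Reasoning
    Y : Carrier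
    Y = y ^ (j ℕ.+ m)
    small : y ^ m + fromℕ m * p * Y ≤ 1#
    small = begin
      y ^ m + fromℕ m * p * Y
        ≲⟨ +-mono-≤ ≤-refl (*-monoˡ-≤ (*-nonneg (0≤fromℕ m) 0≤p) (^-antimonoʳ-≤ 0≤y y≤1 (ℕ.m≤n+m m j))) ⟩
      y ^ m + fromℕ m * p * y ^ m
        ≈⟨ solve 2 (λ a b → b :+ a :* b := b :* (con 1 :+ a)) refl (fromℕ m * p) (y ^ m) ⟩
      y ^ m * (1# + fromℕ m * p)
        ≲⟨ *-monoˡ-≤ (^-nonneg 0≤y m) (1+x≤exp _) ⟩
      y ^ m * exp (fromℕ m * p)
        ≲⟨ y^m*exp≤1 m ⟩
      1# ∎

  -- Here d counts the competitors of the one node that should transmit, so d + 1 is the number of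
  -- informed neighbors. With m = n - d, split `y ^ n` into `y ^ d * y ^ m`; AM-GM bounds
  -- `ν * y ^ m` by d + m yⁿ, and yⁿ ≤ 1 / n turns this into d + 1.
  isolation-bound : ∀ {K} → exp (fromℕ 4) ≤ K → ∀ {d} → d ℕ.≤ n →
                    1# ≤ K * (fromℕ (suc d) * y ^ d)
  isolation-bound {K} e⁴≤K {d} d≤n = begin
    1#                                     ≲⟨ 1≤y^n*ν*K e⁴≤K ⟩
    y ^ n * (ν * K)                        ≡⟨ ≡.cong (λ k → y ^ k * (ν * K)) d+m≡n ⟨
    y ^ (d ℕ.+ m) * (ν * K)                ≈⟨ *-congʳ (^-homo-* y d m) ⟩
    y ^ d * y ^ m * (ν * K)                ≈⟨ solve 4 (λ a b ν K → a :* b :* (ν :* K) := K :* a :* (ν :* b)) refl (y ^ d) (y ^ m) ν K ⟩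
    K * y ^ d * (ν * y ^ m)                ≲⟨ *-monoˡ-≤ (*-nonneg 0≤K (^-nonneg 0≤y d)) ν*y^m≤1+d ⟩
    K * y ^ d * (1# + fromℕ d)             ≈⟨ solve 3 (λ K a b → K :* a :* b := K :* (b :* a)) refl K (y ^ d) (1# + fromℕ d) ⟩
    K * (fromℕ (suc d) * y ^ d)            ∎
    where
    open ≤-Reasoning
    m : ℕ
    m = n ℕ.∸ d
    d+m≡n : d ℕ.+ m ≡ n
    d+m≡n = ℕ.m+[n∸m]≡n d≤n
    0≤K : 0# ≤ K
    0≤K = ≤-trans (0≤exp (0≤fromℕ 4)) e⁴≤K
    ν*y^m≤1+d : ν * y ^ m ≤ 1# + fromℕ d
    ν*y^m≤1+d = begin
      ν * y ^ m                               ≡⟨ ≡.cong (λ k → fromℕ k * y ^ m) d+m≡n ⟨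
      fromℕ (d ℕ.+ m) * y ^ m                 ≲⟨ weighted-AM-GM m d ⟩
      fromℕ d + fromℕ m * y ^ (d ℕ.+ m)       ≡⟨ ≡.cong (λ k → fromℕ d + fromℕ m * y ^ k) d+m≡n ⟩
      fromℕ d + fromℕ m * y ^ n               ≲⟨ +-mono-≤ ≤-refl (*-monoʳ-≤ (^-nonneg 0≤y n) (fromℕ-mono-≤ (ℕ.m∸n≤m n d))) ⟩
      fromℕ d + ν * y ^ n                     ≈⟨ +-congˡ (*-comm ν (y ^ n)) ⟩
      fromℕ d + y ^ n * ν                     ≲⟨ +-mono-≤ ≤-refl y^n*ν≤1 ⟩
      fromℕ d + 1#                            ≈⟨ +-comm (fromℕ d) 1# ⟩
      1# + fromℕ d                            ∎

-- Expectation over independent coins, and the chance of a single transmitter.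

module Expectation {c ℓ₁ ℓ₂} (ℝ : Reals c ℓ₁ ℓ₂) (n : ℕ)
  (p : Reals.Carrier ℝ) (0≤p : Reals._≤_ ℝ (Reals.0# ℝ) p)
  (0≤1-p : Reals._≤_ ℝ (Reals.0# ℝ) (Reals._-_ ℝ (Reals.1# ℝ) p)) where
  open Reals ℝ
  open OrderedField ℝ
  open Network ℝ n
  open Probability p

  private
    y : Carrier
    y = 1# - p

    p+y≈1 : p + y ≈ 1#
    p+y≈1 = x+[y-x]≈y p 1#

  ⟦_⟧ : Bool → Carrier
  ⟦ b ⟧ = if b then 1# else 0#

  0≤⟦_⟧ : ∀ b → 0# ≤ ⟦ b ⟧
  0≤⟦ false ⟧ = ≤-refl
  0≤⟦ true ⟧  = 0≤1

  ⟦b⟧+⟦not-b⟧≈1 : ∀ b → ⟦ b ⟧ + ⟦ not b ⟧ ≈ 1#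
  ⟦b⟧+⟦not-b⟧≈1 true  = +-identityʳ 1#
  ⟦b⟧+⟦not-b⟧≈1 false = +-identityˡ 1#

  𝔼-coins-cong : ∀ m {f g : Subset m → Carrier} → (∀ b → f b ≈ g b) →
                 𝔼-coins m f ≈ 𝔼-coins m g
  𝔼-coins-cong zero    f≈g = f≈g []
  𝔼-coins-cong (suc m) f≈g = +-cong (*-congˡ (𝔼-coins-cong m (f≈g ∘ (inside ∷_))))
                                    (*-congˡ (𝔼-coins-cong m (f≈g ∘ (outside ∷_))))

  𝔼-coins-mono : ∀ m {f g : Subset m → Carrier} → (∀ b → f b ≤ g b) →
                 𝔼-coins m f ≤ 𝔼-coins m g
  𝔼-coins-mono zero    f≤g = f≤g []
  𝔼-coins-mono (suc m) f≤g = +-mono-≤ (*-monoˡ-≤ 0≤p (𝔼-coins-mono m (f≤g ∘ (inside ∷_))))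
                                      (*-monoˡ-≤ 0≤1-p (𝔼-coins-mono m (f≤g ∘ (outside ∷_))))

  𝔼-coins-const : ∀ m a → 𝔼-coins m (λ _ → a) ≈ a
  𝔼-coins-const zero    a = refl
  𝔼-coins-const (suc m) a = begin
    p * 𝔼-coins m (λ _ → a) + y * 𝔼-coins m (λ _ → a) ≈⟨ distribʳ _ p y ⟨
    (p + y) * 𝔼-coins m (λ _ → a)                     ≈⟨ *-cong p+y≈1 (𝔼-coins-const m a) ⟩
    1# * a                                            ≈⟨ *-identityˡ a ⟩
    a                                                 ∎
    where open ≈-Reasoning

  𝔼-coins-+ : ∀ m (f g : Subset m → Carrier) →
              𝔼-coins m (λ b → f b + g b) ≈ 𝔼-coins m f + 𝔼-coins m g
  𝔼-coins-+ zero    f g = refl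
  𝔼-coins-+ (suc m) f g = trans
    (+-cong (*-congˡ (𝔼-coins-+ m _ _)) (*-congˡ (𝔼-coins-+ m _ _)))
    (solve 6 (λ p y a b c d → p :* (a :+ b) :+ y :* (c :+ d) := (p :* a :+ y :* c) :+ (p :* b :+ y :* d))
      refl p y _ _ _ _)

  𝔼-coins-* : ∀ m a (f : Subset m → Carrier) →
              𝔼-coins m (λ b → a * f b) ≈ a * 𝔼-coins m f
  𝔼-coins-* zero    a f = refl
  𝔼-coins-* (suc m) a f = trans
    (+-cong (*-congˡ (𝔼-coins-* m a _)) (*-congˡ (𝔼-coins-* m a _)))
    (solve 5 (λ p y a b c → p :* (a :* b) :+ y :* (a :* c) := a :* (p :* b :+ y :* c)) refl p y a _ _)

  𝔼-cong : ∀ k {f g : History k → Carrier} → (∀ h → f h ≈ g h) → 𝔼 k f ≈ 𝔼 k g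
  𝔼-cong zero    f≈g = f≈g []
  𝔼-cong (suc k) f≈g = 𝔼-cong k (λ h → 𝔼-coins-cong n (λ b → f≈g (b ∷ h)))

  𝔼-mono : ∀ k {f g : History k → Carrier} → (∀ h → f h ≤ g h) → 𝔼 k f ≤ 𝔼 k g
  𝔼-mono zero    f≤g = f≤g []
  𝔼-mono (suc k) f≤g = 𝔼-mono k (λ h → 𝔼-coins-mono n (λ b → f≤g (b ∷ h)))

  𝔼-const : ∀ k a → 𝔼 k (λ _ → a) ≈ a
  𝔼-const zero    a = refl
  𝔼-const (suc k) a = trans (𝔼-cong k (λ _ → 𝔼-coins-const n a)) (𝔼-const k a)

  𝔼-+ : ∀ k (f g : History k → Carrier) → 𝔼 k (λ h → f h + g h) ≈ 𝔼 k f + 𝔼 k g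
  𝔼-+ zero    f g = refl
  𝔼-+ (suc k) f g = trans (𝔼-cong k (λ _ → 𝔼-coins-+ n _ _)) (𝔼-+ k _ _)

  𝔼-* : ∀ k a (f : History k → Carrier) → 𝔼 k (λ h → a * f h) ≈ a * 𝔼 k f
  𝔼-* zero    a f = refl
  𝔼-* (suc k) a f = trans (𝔼-cong k (λ _ → 𝔼-coins-* n a _)) (𝔼-* k a _)

  𝔼-supermartingale : (W : ∀ {k} → History k → Carrier) →
    (∀ {k} (h : History k) → 𝔼-coins n (λ b → W (b ∷ h)) ≤ W h) → ∀ k → 𝔼 k W ≤ W []
  𝔼-supermartingale W step zero    = ≤-refl
  𝔼-supermartingale W step (suc k) = ≤-trans (𝔼-mono k step) (𝔼-supermartingale W step k)

  𝔼-none : ∀ {m} (N : Subset m) → 𝔼-coins m (λ b → ⟦ ∣ N ∩ b ∣ ≡ᵇ 0 ⟧) ≈ y ^ ∣ N ∣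
  𝔼-none []                = refl
  𝔼-none {suc m} (inside ∷ N)  = begin
    p * 𝔼-coins m (λ _ → 0#) + y * 𝔼-coins m (λ b → ⟦ ∣ N ∩ b ∣ ≡ᵇ 0 ⟧)
      ≈⟨ +-cong (*-congˡ (𝔼-coins-const m 0#)) (*-congˡ (𝔼-none N)) ⟩
    p * 0# + y * y ^ ∣ N ∣ ≈⟨ +-congʳ (zeroʳ p) ⟩
    0# + y * y ^ ∣ N ∣     ≈⟨ +-identityˡ _ ⟩
    y * y ^ ∣ N ∣          ∎
    where open ≈-Reasoning
  𝔼-none (outside ∷ N) = trans (sym (distribʳ _ p y))
    (trans (*-cong p+y≈1 (𝔼-none N)) (*-identityˡ _))

  -- The first coin of a member either is the only success, with none after it, or fails and leaves
  -- the task to the rest. For empty `N` the value of `ℕ.pred` is immaterial, as the factor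
  -- `fromℕ 0` vanishes.
  𝔼-exactly-one : ∀ {m} (N : Subset m) →
    𝔼-coins m (λ b → ⟦ ∣ N ∩ b ∣ ≡ᵇ 1 ⟧) ≈ fromℕ ∣ N ∣ * p * y ^ ℕ.pred ∣ N ∣
  𝔼-exactly-one [] = sym (trans (*-congʳ (zeroˡ p)) (zeroˡ 1#))
  𝔼-exactly-one (inside ∷ N) = trans
    (+-cong (*-congˡ (𝔼-none N)) (*-congˡ (𝔼-exactly-one N))) (one-more ∣ N ∣)
    where
    one-more : ∀ d → p * y ^ d + y * (fromℕ d * p * y ^ ℕ.pred d) ≈ (1# + fromℕ d) * p * y ^ d
    one-more zero    = solve 3 (λ p y o → p :* o :+ y :* (con 0 :* p :* o) := (con 1 :+ con 0) :* p :* o) refl p y 1#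
    one-more (suc d) = solve 4 (λ p y D Y → p :* (y :* Y) :+ y :* ((con 1 :+ D) :* p :* Y)
      := (con 1 :+ (con 1 :+ D)) :* p :* (y :* Y)) refl p y (fromℕ d) (y ^ d)
  𝔼-exactly-one (outside ∷ N) = trans (sym (distribʳ _ p y))
    (trans (*-cong p+y≈1 (𝔼-exactly-one N)) (*-identityˡ _))

  -- Beyond 0 ≤ p ≤ 1, this is the only fact about p that the tail bound uses.
  IsolatesAtRate : Carrier → Set ℓ₂
  IsolatesAtRate x = ∀ (N : Subset n) → 1 ℕ.≤ ∣ N ∣ →
                     x ≤ 𝔼-coins n (λ b → ⟦ ∣ N ∩ b ∣ ≡ᵇ 1 ⟧)

-- Membership in decidable subsets, and subsets of size 0 or 1.

module Subsets where
  private variable m : ℕ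

  module _ {a} {P : Pred (Fin m) a} (P? : Decidable P) where

    ∈-tabulate⁺ : ∀ {u} → P u → u ∈ tabulate (does ∘ P?)
    ∈-tabulate⁺ {u} Pu =
      lookup⇒[]= u _ (≡.trans (lookup∘tabulate (does ∘ P?) u) (dec-true (P? u) Pu))

    ∈-tabulate⁻ : ∀ {u} → u ∈ tabulate (does ∘ P?) → P u
    ∈-tabulate⁻ {u} u∈ with P? u | ≡.trans (≡.sym (lookup∘tabulate (does ∘ P?) u)) ([]=⇒lookup u∈)
    ... | yes Pu | _ = Pu

  ∣p∣≡0⇒∉ : ∀ (p : Subset m) → ∣ p ∣ ≡ 0 → ∀ {w} → w ∉ p
  ∣p∣≡0⇒∉ (outside ∷ p) eq (there w∈p) = ∣p∣≡0⇒∉ p eq w∈p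

  ∣p∣≡1⇒singleton : ∀ (p : Subset m) → ∣ p ∣ ≡ 1 → ∃[ v ] v ∈ p × (∀ w → w ∈ p → w ≡ v)
  ∣p∣≡1⇒singleton (inside ∷ p) eq = zero , here ,
    λ { zero _ → ≡.refl ; (suc w) (there w∈p) → contradiction w∈p (∣p∣≡0⇒∉ p (ℕ.suc-injective eq)) }
  ∣p∣≡1⇒singleton (outside ∷ p) eq = let v , v∈p , unique = ∣p∣≡1⇒singleton p eq in
    suc v , there v∈p , λ { (suc w) (there w∈p) → ≡.cong suc (unique w w∈p) }

-- Symmetry of the distance.

module Distance {c ℓ₁ ℓ₂} (ℝ : Reals c ℓ₁ ℓ₂) (n : ℕ) where
  open Reals ℝ
  open OrderedField ℝ
  open Network ℝ n

  private variable x y : Carrier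

  private
    x+y≈0⇒x*x≈y*y : x + y ≈ 0# → x * x ≈ y * y
    x+y≈0⇒x*x≈y*y {x} {y} x+y≈0 = begin
      x * x               ≈⟨ +-identityʳ _ ⟨
      x * x + 0#          ≈⟨ +-congˡ (trans (*-congˡ x+y≈0) (zeroʳ y)) ⟨
      x * x + y * (x + y) ≈⟨ solve 2 (λ x y → x :* x :+ y :* (x :+ y) := x :* (x :+ y) :+ y :* y) refl x y ⟩
      x * (x + y) + y * y ≈⟨ +-congʳ (trans (*-congˡ x+y≈0) (zeroʳ x)) ⟩
      0# + y * y          ≈⟨ +-identityˡ _ ⟩
      y * y               ∎
      where open ≈-Reasoning

    -- The sign of x cannot be decided, but a negative square refutes both signs; then tightness of
    -- apartness forces x ≈ 0, whose square is not negative.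
    0≤x*x : ∀ x → 0# ≤ x * x
    0≤x*x x x*x<0 = <-irrefl (trans (*-congʳ x≈0) (zeroˡ x)) x*x<0
      where
      x≮0 : ¬ (x < 0#)
      x≮0 x<0 = <⇒≤ (<-respʳ-≈ (sym (x+y≈0⇒x*x≈y*y (-‿inverseʳ x))) (*-pos 0<-x 0<-x)) x*x<0
        where
        0<-x : 0# < - x
        0<-x = <-respˡ-≈ (-‿inverseʳ x) (<-respʳ-≈ (+-identityˡ (- x)) (+-monoˡ-< (- x) x<0))
      x≈0 : x ≈ 0#
      x≈0 = proj₁ (tight x 0#) λ x#0 →
        [ x≮0 , (λ 0<x → <⇒≤ (*-pos 0<x 0<x) x*x<0) ]′ (#⇒<⊎> x#0)

    -- Congruence of `sqrt` is derived from its laws: `sqrt y < sqrt x` would square to y < x.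
    sqrt-≤ : 0# ≤ x → 0# ≤ y → x ≈ y → sqrt x ≤ sqrt y
    sqrt-≤ {x} {y} 0≤x 0≤y x≈y √y<√x = <-irrefl (sym x≈y)
      (<-respˡ-≈ (sqrt-square 0≤y) (<-respʳ-≈ (sqrt-square 0≤x)
        (≤-<-trans (*-monoˡ-≤ (sqrt-nonneg 0≤y) (<⇒≤ √y<√x))
          (<-respˡ-≈ (*-comm _ _) (*-monoˡ-< (≤-<-trans (sqrt-nonneg 0≤y) √y<√x) √y<√x)))))

  -- A contact lists the informed node first, whereas reception is measured from the receiver.
  dist-sym : ∀ u v → dist u v ≤ dist v u
  dist-sym (x₁ , y₁) (x₂ , y₂) =
    sqrt-≤ (+-nonneg (0≤x*x _) (0≤x*x _)) (+-nonneg (0≤x*x _) (0≤x*x _))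
      (+-cong (x+y≈0⇒x*x≈y*y (opposite x₁ x₂)) (x+y≈0⇒x*x≈y*y (opposite y₁ y₂)))
    where
    opposite : ∀ a b → (a - b) + (b - a) ≈ 0#
    opposite a b = begin
      (a - b) + (b - a)     ≈⟨ solve 4 (λ a a′ b b′ → (a :+ b′) :+ (b :+ a′) := (a :+ a′) :+ (b :+ b′)) refl a (- a) b (- b) ⟩
      (a - a) + (b - b)     ≈⟨ +-cong (-‿inverseʳ a) (-‿inverseʳ b) ⟩
      0# + 0#               ≈⟨ +-identityˡ 0# ⟩
      0#                    ∎
      where open ≈-Reasoning

-- Covered nodes, links and reception along a history.

module Dynamics {c ℓ₁ ℓ₂} (ℝ : Reals c ℓ₁ ℓ₂) (n : ℕ)
  {r Vmax : RealArithmetic.ℝ⁺ ℝ} (A : Network.Adversary ℝ n r Vmax) (s : Fin n) where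
  open Reals ℝ using (_≤_)
  open OrderedField ℝ using (≤-trans)
  open Subsets
  open Distance ℝ n
  open Network ℝ n
  open Execution A s

  Neighbors-sym : ∀ {k} (h : History k) {u v} → At.Neighbors h u v → At.Neighbors h v u
  Neighbors-sym h (u≢v , d≤r) = u≢v ∘ ≡.sym , ≤-trans (dist-sym _ _) d≤r

  informed⊆covered : ∀ {k} (h : History k) → informed h ⊆ covered h
  held⊆covered     : ∀ {k} (h : History k) → held h ⊆ covered h
  informed⊆covered h u∈ = held⊆covered h (proj₁ (x∈p∩q⁻ (held h) _ u∈))
  held⊆covered []      u∈ = u∈
  held⊆covered (b ∷ h) u∈ with x∈p∪q⁻ (informed h) (received b h) u∈
  ... | inj₁ u∈informed = x∈p∪q⁺ (inj₁ (informed⊆covered h u∈informed))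
  ... | inj₂ u∈received = x∈p∪q⁺ (inj₂ u∈received)

  covered-grows : ∀ {k} b (h : History k) → covered h ⊆ covered (b ∷ h)
  covered-grows b h = p⊆p∪q (received b h)

  Link : ∀ {k} → History k → Node → Node → Set ℓ₂
  Link h p p′ = p ∈ informed h × p′ ∉ covered h × p′ ∈ At.active h × At.Neighbors h p p′

  Linked : ∀ {k} → History k → Set ℓ₂
  Linked h = ∃[ p ] ∃[ p′ ] Link h p p′

  linked? : ∀ {k} (h : History k) → Dec (Linked h)
  linked? h = Fin.any? λ p → Fin.any? λ p′ →
    (p ∈? informed h) ×-dec ¬? (p′ ∈? covered h) ×-dec (p′ ∈? At.active h) ×-dec At.neighbors? h p p′

  links : ∀ {k} → History k → ℕ
  links []      = 0
  links (b ∷ h) = (if does (linked? h) then 1 else 0) ℕ.+ links h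

  informedNeighbors : ∀ {k} → History k → Node → Subset n
  informedNeighbors h u = tabulate (λ w → does ((w ∈? informed h) ×-dec At.neighbors? h u w))

  link⇒∈informedNeighbors : ∀ {k} (h : History k) {p p′} → Link h p p′ → p ∈ informedNeighbors h p′
  link⇒∈informedNeighbors h (p∈ , _ , _ , pp′) =
    ∈-tabulate⁺ (λ w → (w ∈? informed h) ×-dec At.neighbors? h _ w) (p∈ , Neighbors-sym h pp′)

  -- Reception also demands that the receiver be silent. It is, because informed nodes are covered
  -- and `p′` is not; every other possible interferer lies in `informedNeighbors h p′`.
  isolated⇒received : ∀ {k} (h : History k) b {p p′} → Link h p p′ →
    ∣ informedNeighbors h p′ ∩ b ∣ ≡ 1 → p′ ∈ received b h
  isolated⇒received h b {p} {u} (_ , u∉covered , u-active , _) one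
    with v , v∈N∩b , unique ← ∣p∣≡1⇒singleton (informedNeighbors h u ∩ b) one
    with v∈N , v∈b ← x∈p∩q⁻ (informedNeighbors h u) b v∈N∩b
    with v∈informed , uv ← ∈-tabulate⁻ (λ w → (w ∈? informed h) ×-dec At.neighbors? h u w) v∈N =
    ∈-tabulate⁺ (λ u → Fin.any? (At.receives? h (informed h ∩ b) u))
      (v , u-active , uv , x∈p∩q⁺ (v∈informed , v∈b) , only)
    where
    only : ∀ w → w ∈ informed h ∩ b → w ≡ u ⊎ At.Neighbors h u w → w ≡ v
    only w w∈tx (inj₁ ≡.refl) =
      contradiction (informed⊆covered h (proj₁ (x∈p∩q⁻ (informed h) b w∈tx))) u∉covered
    only w w∈tx (inj₂ uw) = let w∈informed , w∈b = x∈p∩q⁻ (informed h) b w∈tx in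
      unique w (x∈p∩q⁺ (∈-tabulate⁺ (λ w → (w ∈? informed h) ×-dec At.neighbors? h u w)
                           (w∈informed , uw) , w∈b))

  ∣covered∣-mono : ∀ {k} b (h : History k) → ∣ covered h ∣ ℕ.≤ ∣ covered (b ∷ h) ∣
  ∣covered∣-mono b h = p⊆q⇒∣p∣≤∣q∣ (covered-grows b h)

  ∣covered∣-strict : ∀ {k} b (h : History k) {u} → u ∉ covered h → u ∈ covered (b ∷ h) →
                     ∣ covered h ∣ ℕ.< ∣ covered (b ∷ h) ∣
  ∣covered∣-strict b h {u} u∉ u∈ = p⊂q⇒∣p∣<∣q∣ (covered-grows b h , u , u∈ , u∉)

  -- Probability lives on finite histories but connectivity on infinite coin sequences. The coins
  -- after the end of the history are an arbitrary default.
  extend : ∀ {k} → History k → ℕ → Coins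
  extend []                  _ = tabulate (λ _ → outside)
  extend (_∷_ {n = k} b h) j = if does (j ℕ.≟ k) then b else extend h j

  prefix-cong : ∀ k {ω ω′} → (∀ j → j ℕ.< k → ω j ≡ ω′ j) → prefix ω k ≡ prefix ω′ k
  prefix-cong zero    ω≡ω′ = ≡.refl
  prefix-cong (suc k) ω≡ω′ =
    ≡.cong₂ _∷_ (ω≡ω′ k (n<1+n k)) (prefix-cong k (λ j j<k → ω≡ω′ j (ℕ.m<n⇒m<1+n j<k)))

  prefix-extend : ∀ {k} (h : History k) → prefix (extend h) k ≡ h
  prefix-extend [] = ≡.refl
  prefix-extend (_∷_ {n = k} b h) = ≡.cong₂ _∷_ last
    (≡.trans (prefix-cong k earlier) (prefix-extend h))
    where
    last : extend (b ∷ h) k ≡ b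
    last rewrite dec-true (k ℕ.≟ k) ≡.refl = ≡.refl
    earlier : ∀ j → j ℕ.< k → extend (b ∷ h) j ≡ extend h j
    earlier j j<k rewrite dec-false (j ℕ.≟ k) (ℕ.<⇒≢ j<k) = ≡.refl

-- A linkless slot is followed within α slots by a contact, which then links
-- the next β slots unless it ends in a new node being covered.  Hence each
-- stretch of up to α slots before a contact is paid for by β links or by a
-- covered node; `Advances` is this amortisation, multiplied by β.
module Progress {c ℓ₁ ℓ₂} (ℝ : Reals c ℓ₁ ℓ₂) (n : ℕ)
  {r Vmax : RealArithmetic.ℝ⁺ ℝ} (A : Network.Adversary ℝ n r Vmax) (s : Fin n) (α β : ℕ)
  (ω : ℕ → Network.Coins ℝ n) where
  open Network ℝ n
  open Execution A s
  open Dynamics ℝ n A s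
  open ℕSolver.+-*-Solver using (solve; _:=_; _:+_; _:*_)

  -- Measured in units of 1/β slot, a covered node pays for α slots and a link for 1 + α/β: its own
  -- slot and a share of the gap before it.
  coveredAt linksAt potential : ℕ → ℕ
  coveredAt t = ∣ covered (prefix ω t) ∣
  linksAt   t = links (prefix ω t)
  potential t = α ℕ.* β ℕ.* coveredAt t ℕ.+ (α ℕ.+ β) ℕ.* linksAt t

  covered-mono : ∀ {i j} → i ℕ.≤ j → covered (prefix ω i) ⊆ covered (prefix ω j)
  covered-mono = go ∘ ℕ.≤⇒≤′
    where
    go : ∀ {i j} → i ℕ.≤′ j → covered (prefix ω i) ⊆ covered (prefix ω j)
    go (ℕ.≤′-reflexive ≡.refl) u∈ = u∈
    go (ℕ.≤′-step i≤j) u∈ = covered-grows _ _ (go i≤j u∈)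

  coveredAt-mono : ∀ {i j} → i ℕ.≤ j → coveredAt i ℕ.≤ coveredAt j
  coveredAt-mono i≤j = p⊆q⇒∣p∣≤∣q∣ (covered-mono i≤j)

  linksAt-mono : ∀ {i j} → i ℕ.≤ j → linksAt i ℕ.≤ linksAt j
  linksAt-mono = go ∘ ℕ.≤⇒≤′
    where
    go : ∀ {i j} → i ℕ.≤′ j → linksAt i ℕ.≤ linksAt j
    go (ℕ.≤′-reflexive ≡.refl) = ℕ.≤-refl
    go (ℕ.≤′-step i≤j) = ℕ.≤-trans (go i≤j) (ℕ.m≤n+m _ _)

  linksAt-suc : ∀ {t} → Linked (prefix ω t) → linksAt (suc t) ≡ suc (linksAt t)
  linksAt-suc {t} linked rewrite dec-true (linked? (prefix ω t)) linked = ≡.refl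

  -- A contact asserts that `p` is informed only at its start. Since `p` stays active while `p′` is
  -- uncovered, it never loses I, by induction over the slots; the earlier slots qualify because
  -- `covered` only grows.
  contact⇒link : ∀ {t′ p p′} → Contact β ω t′ p p′ → ∀ {j} → t′ ℕ.≤ j → j ℕ.< t′ ℕ.+ β →
                 p′ ∉ covered (prefix ω j) → Link (prefix ω j) p p′
  contact⇒link {t′} {p} {p′} contact {j} t′≤j j<t′+β p′∉ =
    let _ , p′-active , neighbors = connected j t′≤j j<t′+β p′∉ in
    still-informed (ℕ.≤⇒≤′ t′≤j) j<t′+β p′∉ , p′∉ , p′-active , neighbors
    where
    open Contact contact
    still-informed : ∀ {j} → t′ ℕ.≤′ j → j ℕ.< t′ ℕ.+ β →
                     p′ ∉ covered (prefix ω j) → p ∈ informed (prefix ω j)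
    still-informed (ℕ.≤′-reflexive ≡.refl) _ _ = informed-at-start
    still-informed (ℕ.≤′-step {j} t′≤j) j<t′+β p′∉ = x∈p∩q⁺
      ( x∈p∪q⁺ (inj₁ (still-informed t′≤j (ℕ.<⇒≤ j<t′+β) (p′∉ ∘ covered-grows _ _)))
      , proj₁ (connected (suc j) (ℕ.m≤n⇒m≤1+n (ℕ.≤′⇒≤ t′≤j)) j<t′+β p′∉))

  -- The parameter κ is a debt, nonzero only when the horizon cuts off a stretch that has not yet
  -- been paid for.
  Advances : ℕ → ℕ → ℕ → Set
  Advances κ i j = β ℕ.* j ℕ.+ potential i ℕ.≤ β ℕ.* i ℕ.+ potential j ℕ.+ κ

  -- A stretch has at most g idle slots, d linked ones and at least δ newly covered nodes. Each link
  -- pays β for its own slot and leaves α towards the gap, so only the gap has to be balanced.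
  advance : ∀ {κ i j} g d δ → j ℕ.≤ g ℕ.+ i ℕ.+ d →
            d ℕ.+ linksAt i ℕ.≤ linksAt j → δ ℕ.+ coveredAt i ℕ.≤ coveredAt j →
            β ℕ.* g ℕ.≤ α ℕ.* β ℕ.* δ ℕ.+ α ℕ.* d ℕ.+ κ → Advances κ i j
  advance {κ} {i} {j} g d δ j≤ d≤ δ≤ βg≤ = begin
    β ℕ.* j ℕ.+ potential i
      ≤⟨ ℕ.+-monoˡ-≤ _ (ℕ.*-monoʳ-≤ β j≤) ⟩
    β ℕ.* (g ℕ.+ i ℕ.+ d) ℕ.+ potential i
      ≡⟨ solve 5 (λ b g i d φ → b :* (g :+ i :+ d) :+ φ := b :* g :+ (b :* i :+ b :* d :+ φ)) ≡.refl β g i d (potential i) ⟩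
    β ℕ.* g ℕ.+ (β ℕ.* i ℕ.+ β ℕ.* d ℕ.+ potential i)
      ≤⟨ ℕ.+-monoˡ-≤ _ βg≤ ⟩
    α ℕ.* β ℕ.* δ ℕ.+ α ℕ.* d ℕ.+ κ ℕ.+ (β ℕ.* i ℕ.+ β ℕ.* d ℕ.+ potential i)
      ≡⟨ solve 8 (λ a b i d e k C L → a :* b :* e :+ a :* d :+ k :+ (b :* i :+ b :* d :+ (a :* b :* C :+ (a :+ b) :* L))
           := b :* i :+ (a :* b :* (e :+ C) :+ (a :+ b) :* (d :+ L)) :+ k) ≡.refl α β i d δ κ (coveredAt i) (linksAt i) ⟩
    β ℕ.* i ℕ.+ (α ℕ.* β ℕ.* (δ ℕ.+ coveredAt i) ℕ.+ (α ℕ.+ β) ℕ.* (d ℕ.+ linksAt i)) ℕ.+ κ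
      ≤⟨ ℕ.+-monoˡ-≤ κ (ℕ.+-monoʳ-≤ (β ℕ.* i) (ℕ.+-mono-≤ (ℕ.*-monoʳ-≤ (α ℕ.* β) δ≤) (ℕ.*-monoʳ-≤ (α ℕ.+ β) d≤))) ⟩
    β ℕ.* i ℕ.+ potential j ℕ.+ κ ∎
    where open ℕ.≤-Reasoning

  Advances-trans : ∀ {κ i j k} → Advances 0 i j → Advances κ j k → Advances κ i k
  Advances-trans {κ} {i} {j} {k} ij jk = ℕ.+-cancelˡ-≤ (β ℕ.* j ℕ.+ potential j) _ _ (begin
    β ℕ.* j ℕ.+ potential j ℕ.+ (β ℕ.* k ℕ.+ potential i)
      ≡⟨ solve 4 (λ a b c d → a :+ b :+ (c :+ d) := (a :+ d) :+ (c :+ b)) ≡.refl (β ℕ.* j) (potential j) (β ℕ.* k) (potential i) ⟩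
    (β ℕ.* j ℕ.+ potential i) ℕ.+ (β ℕ.* k ℕ.+ potential j)
      ≤⟨ ℕ.+-mono-≤ (ℕ.≤-trans ij (ℕ.≤-reflexive (ℕ.+-identityʳ _))) jk ⟩
    (β ℕ.* i ℕ.+ potential j) ℕ.+ (β ℕ.* j ℕ.+ potential k ℕ.+ κ)
      ≡⟨ solve 5 (λ a b c d e → (a :+ b) :+ (c :+ d :+ e) := (c :+ b) :+ (a :+ d :+ e)) ≡.refl (β ℕ.* i) (potential j) (β ℕ.* j) (potential k) κ ⟩
    β ℕ.* j ℕ.+ potential j ℕ.+ (β ℕ.* i ℕ.+ potential k ℕ.+ κ) ∎)
    where open ℕ.≤-Reasoning

  -- The strict `t < j` lets the iteration terminate; only `finish` may leave a debt.
  data Outcome (t T : ℕ) : Set where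
    finish : Advances (α ℕ.* β) t T → Outcome t T
    reach  : ∀ j → t ℕ.< j → j ℕ.≤ T → Advances 0 t j → Outcome t T

  links-grow : ∀ {t t′ d k p p′} → Contact β ω t′ p p′ → d ℕ.+ suc k ≡ β →
    d ℕ.+ linksAt t ℕ.≤ linksAt (t′ ℕ.+ d) → p′ ∉ covered (prefix ω (t′ ℕ.+ d)) →
    suc d ℕ.+ linksAt t ℕ.≤ linksAt (suc (t′ ℕ.+ d))
  links-grow {t′ = t′} {d} {k} {p} {p′} contact d+1+k≡β links≥ p′∉ =
    ℕ.≤-trans (s≤s links≥) (ℕ.≤-reflexive (≡.sym (linksAt-suc
      (p , p′ , contact⇒link contact (ℕ.m≤m+n t′ d)
        (ℕ.+-monoʳ-< t′ (ℕ.≤-trans (ℕ.m<m+n d (s≤s z≤n)) (ℕ.≤-reflexive d+1+k≡β))) p′∉))))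

  -- The contact has lasted d slots, all linked, and k remain.
  follow-contact : ∀ {t t′ T p p′} → Contact β ω t′ p p′ → t ℕ.< t′ → t′ ℕ.≤ α ℕ.+ t →
    ∀ d k → d ℕ.+ k ≡ β → t′ ℕ.+ d ℕ.≤ T → d ℕ.+ linksAt t ℕ.≤ linksAt (t′ ℕ.+ d) →
    p′ ∉ covered (prefix ω (t′ ℕ.+ d)) → Outcome t T
  follow-contact {t} {t′} contact t<t′ t′≤α+t d zero d≡β y≤T links≥ p′∉
    rewrite ℕ.+-identityʳ d | d≡β =
    -- The contact ran its full length: β links contributing α each pay for α idle slots.
    reach (t′ ℕ.+ β) (ℕ.<-≤-trans t<t′ (ℕ.m≤m+n t′ β)) y≤T
      (advance α β 0 (ℕ.+-monoˡ-≤ β t′≤α+t) links≥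
        (coveredAt-mono (ℕ.<⇒≤ (ℕ.<-≤-trans t<t′ (ℕ.m≤m+n t′ β))))
        (ℕ.≤-reflexive (solve 2 (λ a b → b :* a := a :* b :* con 0 :+ a :* b :+ con 0) ≡.refl α β)))
    where open ℕSolver.+-*-Solver using (con)
  follow-contact {t} {t′} {T} {p} {p′} contact t<t′ t′≤α+t d (suc k) d+1+k≡β y≤T links≥ p′∉
    with ℕ.m≤n⇒m<n∨m≡n y≤T
  -- The horizon is reached during the contact: the gap is left as a debt of α β.
  ... | inj₂ ≡.refl = finish
      (advance α d 0 (ℕ.+-monoˡ-≤ d t′≤α+t) links≥
        (coveredAt-mono (ℕ.<⇒≤ (ℕ.<-≤-trans t<t′ (ℕ.m≤m+n t′ d))))
        (ℕ.≤-trans (ℕ.≤-reflexive (ℕ.*-comm β α)) (ℕ.m≤n+m _ _)))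
  ... | inj₁ y<T with p′ ∈? covered (prefix ω (suc (t′ ℕ.+ d)))
  -- The contact ended early by covering `p′`, and this node alone pays for the gap.
  ...   | yes p′∈ = reach (suc y) (ℕ.m≤n⇒m≤1+n t<y) y<T
      (advance α (suc d) 1
        (ℕ.≤-trans (ℕ.≤-reflexive (≡.sym (ℕ.+-suc t′ d))) (ℕ.+-monoˡ-≤ (suc d) t′≤α+t))
        (links-grow {t} contact d+1+k≡β links≥ p′∉)
        (ℕ.≤-trans (s≤s (coveredAt-mono (ℕ.<⇒≤ t<y))) (∣covered∣-strict _ _ p′∉ p′∈))
        (ℕ.≤-trans (ℕ.≤-trans (ℕ.≤-reflexive (solve 2 (λ a b → b :* a := a :* b :* con 1) ≡.refl α β))
           (ℕ.m≤m+n _ _)) (ℕ.m≤m+n _ 0)))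
      where
      open ℕSolver.+-*-Solver using (con)
      y = t′ ℕ.+ d
      t<y : t ℕ.< y
      t<y = ℕ.<-≤-trans t<t′ (ℕ.m≤m+n t′ d)
  ...   | no p′∉′ = follow-contact contact t<t′ t′≤α+t (suc d) k
      (≡.trans (≡.sym (ℕ.+-suc d k)) d+1+k≡β)
      (ℕ.≤-trans (ℕ.≤-reflexive (ℕ.+-suc t′ d)) y<T)
      (≡.subst (λ j → suc d ℕ.+ linksAt t ℕ.≤ linksAt j) (≡.sym (ℕ.+-suc t′ d))
        (links-grow {t} contact d+1+k≡β links≥ p′∉))
      (p′∉′ ∘ ≡.subst (λ j → p′ ∈ covered (prefix ω j)) (ℕ.+-suc t′ d))

  module _ {q} {Q : Pred Node q} (connectivity : Connected Q α β ω) {T : ℕ}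
           (unsolved : ¬ Solved Q (prefix ω T)) where

    unlinked-outcome : ∀ {t} → t ℕ.< T → ¬ Linked (prefix ω t) → Outcome t T
    unlinked-outcome {t} t<T unlinked
      with t′ , p , p′ , contact , x , t≤x , x≤t+α , t′≤x , x<t′+β , p′∉ ←
             connectivity t (λ solved → unsolved (λ u Qu → covered-mono t<T (solved u Qu)))
      with ℕ.<-≤-connex t t′
    -- A contact already begun would link slot t itself, for `p′` is still uncovered at the later
    -- slot x. Hence the contact starts after t, within α slots.
    ... | inj₂ t′≤t = contradiction
          (p , p′ , contact⇒link contact t′≤t (ℕ.≤-<-trans t≤x x<t′+β) (p′∉ ∘ covered-mono t≤x)) unlinked
    ... | inj₁ t<t′ with ℕ.<-≤-connex T t′
    ...   | inj₁ T<t′ = finish (advance α 0 0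
            (ℕ.≤-trans (ℕ.<⇒≤ T<t′) (ℕ.≤-trans t′≤α+t (ℕ.m≤m+n _ 0)))
            (linksAt-mono (ℕ.<⇒≤ t<T)) (coveredAt-mono (ℕ.<⇒≤ t<T))
            (ℕ.≤-trans (ℕ.≤-reflexive (ℕ.*-comm β α)) (ℕ.m≤n+m _ _)))
          where
          t′≤α+t : t′ ℕ.≤ α ℕ.+ t
          t′≤α+t = ℕ.≤-trans (ℕ.≤-trans t′≤x x≤t+α) (ℕ.≤-reflexive (ℕ.+-comm t α))
    ...   | inj₂ t′≤T = follow-contact contact t<t′
            (ℕ.≤-trans (ℕ.≤-trans t′≤x x≤t+α) (ℕ.≤-reflexive (ℕ.+-comm t α))) 0 β ≡.refl
            (ℕ.≤-trans (ℕ.≤-reflexive (ℕ.+-identityʳ t′)) t′≤T)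
            (linksAt-mono (ℕ.≤-trans (ℕ.<⇒≤ t<t′) (ℕ.m≤m+n t′ 0)))
            (p′∉ ∘ covered-mono (ℕ.≤-trans (ℕ.≤-reflexive (ℕ.+-identityʳ t′)) t′≤x))

    advances-to-end : ∀ fuel {t} → t ℕ.≤ T → T ℕ.≤ fuel ℕ.+ t → Advances (α ℕ.* β) t T
    advances-to-end fuel {t} t≤T T≤ with ℕ.m≤n⇒m<n∨m≡n t≤T
    advances-to-end fuel {t} t≤T T≤ | inj₂ ≡.refl = ℕ.m≤m+n _ _
    advances-to-end zero {t} t≤T T≤ | inj₁ t<T = contradiction T≤ (ℕ.<⇒≱ t<T)
    advances-to-end (suc fuel) {t} t≤T T≤ | inj₁ t<T with linked? (prefix ω t)
    ... | yes linked = Advances-trans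
            (advance 0 1 0 (ℕ.≤-reflexive (ℕ.+-comm 1 t)) (ℕ.≤-reflexive (≡.sym (linksAt-suc linked)))
              (coveredAt-mono (ℕ.n≤1+n t)) (ℕ.≤-trans (ℕ.≤-reflexive (ℕ.*-zeroʳ β)) z≤n))
            (advances-to-end fuel t<T (ℕ.≤-trans T≤ (ℕ.≤-reflexive (≡.sym (ℕ.+-suc fuel t)))))
    ... | no unlinked with unlinked-outcome t<T unlinked
    ...   | finish adv = adv
    ...   | reach j t<j j≤T adv = Advances-trans adv
            (advances-to-end fuel j≤T (ℕ.≤-trans T≤
              (ℕ.≤-trans (ℕ.≤-reflexive (≡.sym (ℕ.+-suc fuel t))) (ℕ.+-monoʳ-≤ fuel t<j))))

    -- The final debt α β is exactly what the source, covered from the start, puts into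
    -- `potential 0`.
    time-bound : β ℕ.* T ℕ.≤ potential T
    time-bound = ℕ.+-cancelʳ-≤ (potential 0) _ _ (begin
      β ℕ.* T ℕ.+ potential 0                     ≤⟨ advances-to-end T z≤n (ℕ.m≤m+n T 0) ⟩
      β ℕ.* 0 ℕ.+ potential T ℕ.+ α ℕ.* β         ≡⟨ ≡.cong (λ k → k ℕ.+ potential T ℕ.+ α ℕ.* β) (ℕ.*-zeroʳ β) ⟩
      potential T ℕ.+ α ℕ.* β                     ≡⟨ ≡.cong (potential T ℕ.+_) (ℕ.*-identityʳ (α ℕ.* β)) ⟨
      potential T ℕ.+ α ℕ.* β ℕ.* 1               ≡⟨ ≡.cong (λ k → potential T ℕ.+ α ℕ.* β ℕ.* k) (∣⁅x⁆∣≡1 s) ⟨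
      potential T ℕ.+ α ℕ.* β ℕ.* coveredAt 0     ≤⟨ ℕ.+-monoʳ-≤ (potential T) (ℕ.m≤m+n _ _) ⟩
      potential T ℕ.+ potential 0                 ∎)
      where open ℕ.≤-Reasoning

-- Probability of isolating one transmitter in a linked slot.

module SuccessRate {c ℓ₁ ℓ₂} (ℝ : Reals c ℓ₁ ℓ₂)
  (n : ℕ) (n>1 : 1 ℕ.< n) (n>0 : 0 ℕ.< n)
  (K : Reals.Carrier ℝ) (e⁴≤K : Reals._≤_ ℝ (Reals.exp ℝ (Reals.fromℕ ℝ 4)) K) where
  open Reals ℝ
  open RealArithmetic ℝ
  open OrderedField ℝ
  open Exponential ℝ
  open LogarithmicRate ℝ n n>1 n>0
  open Expectation ℝ n p 0≤p 0≤y
  open Network ℝ n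
  open Probability p

  0<K : 0# < K
  0<K = <-≤-trans (0<exp (0≤fromℕ 4)) e⁴≤K

  0<K+K : 0# < K + K
  0<K+K = <-≤-trans 0<K (x≤x+y (<⇒≤ 0<K))

  rate : Carrier
  rate = p / (K + K , 0<K+K)

  rate*[K+K]≈p : rate * (K + K) ≈ p
  rate*[K+K]≈p = /-cancel p (K + K , 0<K+K)

  0≤rate : 0# ≤ rate
  0≤rate = /-nonneg (K + K , 0<K+K) 0≤p

  rate-isolates : IsolatesAtRate (rate + rate)
  rate-isolates N 1≤∣N∣ =
    ≤-trans (bound ∣ N ∣ 1≤∣N∣ (∣p∣≤n N)) (≤-reflexive (sym (𝔼-exactly-one N)))
    where
    open ≤-Reasoning
    bound : ∀ d → 1 ℕ.≤ d → d ℕ.≤ n → rate + rate ≤ fromℕ d * p * y ^ ℕ.pred d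
    bound (suc d) _ 1+d≤n = *-cancelˡ-≤ 0<K (begin
      K * (rate + rate)                ≈⟨ solve 2 (λ K x → K :* (x :+ x) := x :* (K :+ K)) refl K rate ⟩
      rate * (K + K)                   ≈⟨ rate*[K+K]≈p ⟩
      p                                ≈⟨ *-identityʳ p ⟨
      p * 1#                           ≲⟨ *-monoˡ-≤ 0≤p (isolation-bound e⁴≤K (ℕ.<⇒≤ 1+d≤n)) ⟩
      p * (K * (fromℕ (suc d) * y ^ d)) ≈⟨ solve 4 (λ p K a b → p :* (K :* (a :* b)) := K :* (a :* p :* b)) refl p K (fromℕ (suc d)) (y ^ d) ⟩
      K * (fromℕ (suc d) * p * y ^ d)  ∎)

-- The supermartingale and the tail bound.

module Concentration {c ℓ₁ ℓ₂} (ℝ : Reals c ℓ₁ ℓ₂) (n : ℕ)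
  (p : Reals.Carrier ℝ) (0≤p : Reals._≤_ ℝ (Reals.0# ℝ) p)
  (0≤1-p : Reals._≤_ ℝ (Reals.0# ℝ) (Reals._-_ ℝ (Reals.1# ℝ) p))
  (rate : Reals.Carrier ℝ) (0≤rate : Reals._≤_ ℝ (Reals.0# ℝ) rate)
  (rate-isolates : Expectation.IsolatesAtRate ℝ n p 0≤p 0≤1-p (Reals._+_ ℝ rate rate))
  {r Vmax : RealArithmetic.ℝ⁺ ℝ} (A : Network.Adversary ℝ n r Vmax) (s : Fin n) where
  open Reals ℝ
  open Network ℝ n
  open Probability p
  open OrderedField ℝ
  open Exponential ℝ
  open Expectation ℝ n p 0≤p 0≤1-p
  open Execution A s
  open Dynamics ℝ n A s

  weight : ∀ {k} → History k → Carrier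
  weight h = exp rate ^ links h * e⁻¹ ^ ∣ covered h ∣

  0≤weight : ∀ {k} (h : History k) → 0# ≤ weight h
  0≤weight h = *-nonneg (^-nonneg (0≤exp 0≤rate) (links h)) (^-nonneg 0≤e⁻¹ ∣ covered h ∣)

  -- Only the covering of `v` by an isolated transmitter is credited; any other covering lowers the
  -- weight further. With P the isolation probability, the factor from coverings has mean at most 1
  -- - P + P / e ≤ 1 - rate, and (1 - rate) exp rate ≤ 1 absorbs the factor of the new link.
  linked-step : ∀ {k} (h : History k) {u v} → Link h u v →
    𝔼-coins n (λ b → exp rate ^ suc (links h) * e⁻¹ ^ ∣ covered (b ∷ h) ∣) ≤ weight h
  linked-step h {u} {v} link = begin
    𝔼-coins n (λ b → a ^ suc (links h) * e⁻¹ ^ ∣ covered (b ∷ h) ∣)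
      ≲⟨ 𝔼-coins-mono n pointwise ⟩
    𝔼-coins n (λ b → weight h * a * (⟦ not (one b) ⟧ + e⁻¹ * ⟦ one b ⟧))
      ≈⟨ 𝔼-coins-* n (weight h * a) _ ⟩
    weight h * a * 𝔼-coins n (λ b → ⟦ not (one b) ⟧ + e⁻¹ * ⟦ one b ⟧)
      ≈⟨ *-congˡ (trans (𝔼-coins-+ n _ _) (+-congˡ (𝔼-coins-* n e⁻¹ _))) ⟩
    weight h * a * (P′ + e⁻¹ * P)
      ≈⟨ solve 3 (λ w a v → w :* a :* v := w :* (v :* a)) refl (weight h) a _ ⟩
    weight h * ((P′ + e⁻¹ * P) * a)
      ≲⟨ *-monoˡ-≤ (0≤weight h) (complement-*-exp decrease 0≤rate) ⟩
    weight h * 1#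
      ≈⟨ *-identityʳ _ ⟩
    weight h ∎
    where
    open ≤-Reasoning
    a P P′ : Carrier
    a = exp rate
    N : Subset n
    N = informedNeighbors h v
    one : Coins → Bool
    one b = ∣ N ∩ b ∣ ≡ᵇ 1
    P  = 𝔼-coins n (λ b → ⟦ one b ⟧)
    P′ = 𝔼-coins n (λ b → ⟦ not (one b) ⟧)

    1≤∣N∣ : 1 ℕ.≤ ∣ N ∣
    1≤∣N∣ = ℕ.≤-trans (ℕ.≤-reflexive (≡.sym (∣⁅x⁆∣≡1 u)))
      (p⊆q⇒∣p∣≤∣q∣ (λ w∈ → ≡.subst (_∈ N) (≡.sym (x∈⁅y⁆⇒x≡y u w∈)) (link⇒∈informedNeighbors h link)))

    pointwise : ∀ b → a ^ suc (links h) * e⁻¹ ^ ∣ covered (b ∷ h) ∣ ≤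
                      weight h * a * (⟦ not (one b) ⟧ + e⁻¹ * ⟦ one b ⟧)
    pointwise b = ≤-trans (*-monoˡ-≤ (^-nonneg (0≤exp 0≤rate) (suc (links h))) z^≤)
      (≤-reflexive (solve 4 (λ a L C v → a :* L :* (C :* v) := L :* C :* a :* v) refl
        a (a ^ links h) (e⁻¹ ^ ∣ covered h ∣) _))
      where
      z^≤ : e⁻¹ ^ ∣ covered (b ∷ h) ∣ ≤ e⁻¹ ^ ∣ covered h ∣ * (⟦ not (one b) ⟧ + e⁻¹ * ⟦ one b ⟧)
      z^≤ with one b in eq
      ... | false = ≤-trans (^-antimonoʳ-≤ 0≤e⁻¹ e⁻¹≤1 (∣covered∣-mono b h))
        (≤-reflexive (solve 2 (λ C z → C := C :* (con 1 :+ z :* con 0)) refl _ e⁻¹))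
      ... | true = ≤-trans (^-antimonoʳ-≤ 0≤e⁻¹ e⁻¹≤1 (∣covered∣-strict b h v∉ v∈))
        (≤-reflexive (solve 2 (λ C z → z :* C := C :* (con 0 :+ z :* con 1)) refl _ e⁻¹))
        where
        v∉ : v ∉ covered h
        v∉ = proj₁ (proj₂ link)
        v∈ : v ∈ covered (b ∷ h)
        v∈ = x∈p∪q⁺ (inj₂ (isolated⇒received h b link
          (ℕ.≡ᵇ⇒≡ _ 1 (≡.subst Bool.T (≡.sym eq) _))))

    P+P′≈1 : P + P′ ≈ 1#
    P+P′≈1 = trans (sym (𝔼-coins-+ n _ _))
      (trans (𝔼-coins-cong n (λ b → ⟦b⟧+⟦not-b⟧≈1 (one b))) (𝔼-coins-const n 1#))

    0≤P : 0# ≤ P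
    0≤P = ≤-trans (≤-reflexive (sym (𝔼-coins-const n 0#))) (𝔼-coins-mono n (λ b → 0≤⟦ one b ⟧))

    rate+e⁻¹*P≤P : rate + e⁻¹ * P ≤ P
    rate+e⁻¹*P≤P = *-cancelˡ-≤ (<-≤-trans 0<1 (x≤x+y 0≤1)) (begin
      (1# + 1#) * (rate + e⁻¹ * P)         ≈⟨ solve 3 (λ x z P → con 2 :* (x :+ z :* P) := (x :+ x) :+ (z :+ z) :* P) refl rate e⁻¹ P ⟩
      (rate + rate) + (e⁻¹ + e⁻¹) * P      ≲⟨ +-mono-≤ (rate-isolates N 1≤∣N∣) (*-monoʳ-≤ 0≤P e⁻¹+e⁻¹≤1) ⟩
      P + 1# * P                           ≈⟨ solve 1 (λ P → P :+ con 1 :* P := con 2 :* P) refl P ⟩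
      (1# + 1#) * P                        ∎)

    decrease : rate + (P′ + e⁻¹ * P) ≤ 1#
    decrease = begin
      rate + (P′ + e⁻¹ * P) ≈⟨ solve 3 (λ a b c → a :+ (b :+ c) := (a :+ c) :+ b) refl rate P′ _ ⟩
      rate + e⁻¹ * P + P′   ≲⟨ +-mono-≤ rate+e⁻¹*P≤P ≤-refl ⟩
      P + P′                ≈⟨ P+P′≈1 ⟩
      1#                    ∎

  weight-step : ∀ {k} (h : History k) → 𝔼-coins n (λ b → weight (b ∷ h)) ≤ weight h
  weight-step h with linked? h
  ... | yes (u , v , link) = linked-step h link
  ... | no _ = ≤-trans
    (𝔼-coins-mono n (λ b → *-monoˡ-≤ (^-nonneg (0≤exp 0≤rate) (links h))
      (^-antimonoʳ-≤ 0≤e⁻¹ e⁻¹≤1 (∣covered∣-mono b h))))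
    (≤-reflexive (𝔼-coins-const n (weight h)))

  𝔼-weight≤1 : ∀ k → 𝔼 k weight ≤ 1#
  𝔼-weight≤1 k = begin
    𝔼 k weight                  ≲⟨ 𝔼-supermartingale weight weight-step k ⟩
    1# * e⁻¹ ^ ∣ ⁅ s ⁆ ∣        ≈⟨ *-identityˡ _ ⟩
    e⁻¹ ^ ∣ ⁅ s ⁆ ∣             ≲⟨ ^-antimonoʳ-≤ 0≤e⁻¹ e⁻¹≤1 {k = ∣ ⁅ s ⁆ ∣} z≤n ⟩
    1#                          ∎
    where open ≤-Reasoning

  -- Markov's inequality in pointwise form: on unsolved histories `e⁻¹ ^ n * weight h` is at least
  -- 1, because the links supply e²ⁿ and at most n nodes are covered. Taking expectations finishes.
  Pr-solved : ∀ {q} {Q : Pred Node q} (Q? : Decidable Q) {M T} →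
    fromℕ n + fromℕ n ≤ fromℕ M * rate →
    (∀ (h : History T) → ¬ Solved Q h → M ℕ.≤ links h) →
    1# ≤ Pr T (solved? Q?) + e⁻¹ ^ n
  Pr-solved {Q = Q} Q? {M} {T} 2ν≤M*rate links≥M = begin
    1#                                            ≈⟨ 𝔼-const T 1# ⟨
    𝔼 T (λ _ → 1#)                                ≲⟨ 𝔼-mono T pointwise ⟩
    𝔼 T (λ h → ⟦ does (solved? Q? h) ⟧ + e⁻¹ ^ n * weight h)
      ≈⟨ trans (𝔼-+ T _ _) (+-congˡ (𝔼-* T (e⁻¹ ^ n) weight)) ⟩
    Pr T (solved? Q?) + e⁻¹ ^ n * 𝔼 T weight
      ≲⟨ +-mono-≤ ≤-refl (*-monoˡ-≤ (^-nonneg 0≤e⁻¹ n) (𝔼-weight≤1 T)) ⟩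
    Pr T (solved? Q?) + e⁻¹ ^ n * 1#              ≈⟨ +-congˡ (*-identityʳ _) ⟩
    Pr T (solved? Q?) + e⁻¹ ^ n                   ∎
    where
    open ≤-Reasoning
    e²ⁿ≤ : exp 1# ^ n * exp 1# ^ n ≤ exp rate ^ M
    e²ⁿ≤ = begin
      exp 1# ^ n * exp 1# ^ n     ≈⟨ ^-homo-* (exp 1#) n n ⟨
      exp 1# ^ (n ℕ.+ n)          ≈⟨ exp-fromℕ (n ℕ.+ n) 1# ⟨
      exp (fromℕ (n ℕ.+ n) * 1#)  ≈⟨ exp-cong (trans (*-identityʳ _) (fromℕ-+ n n)) ⟩
      exp (fromℕ n + fromℕ n)     ≲⟨ exp-mono-≤ (+-nonneg (0≤fromℕ n) (0≤fromℕ n)) 2ν≤M*rate ⟩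
      exp (fromℕ M * rate)        ≈⟨ exp-fromℕ M rate ⟩
      exp rate ^ M                ∎
    pointwise : ∀ h → 1# ≤ ⟦ does (solved? Q? h) ⟧ + e⁻¹ ^ n * weight h
    pointwise h = by-cases (solved? Q? h)
      where
      by-cases : (d : Dec (Solved Q h)) → 1# ≤ ⟦ does d ⟧ + e⁻¹ ^ n * weight h
      by-cases (yes _) = x≤x+y (*-nonneg (^-nonneg 0≤e⁻¹ n) (0≤weight h))
      by-cases (no unsolved) = begin
        1#
          ≈⟨ trans (*-cong (e⁻¹^n*e^n≈1 n) (e⁻¹^n*e^n≈1 n)) (*-identityˡ 1#) ⟨
        e⁻¹ ^ n * exp 1# ^ n * (e⁻¹ ^ n * exp 1# ^ n)
          ≈⟨ solve 2 (λ z e → z :* e :* (z :* e) := z :* (e :* e :* z)) refl (e⁻¹ ^ n) (exp 1# ^ n) ⟩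
        e⁻¹ ^ n * (exp 1# ^ n * exp 1# ^ n * e⁻¹ ^ n)
          ≲⟨ *-monoˡ-≤ (^-nonneg 0≤e⁻¹ n) (*-mono-≤ (*-nonneg 0≤eⁿ 0≤eⁿ) (^-nonneg 0≤e⁻¹ ∣ covered h ∣)
               (≤-trans e²ⁿ≤ (^-monoʳ-≤ (1≤exp 0≤rate) (links≥M h unsolved)))
               (^-antimonoʳ-≤ 0≤e⁻¹ e⁻¹≤1 (∣p∣≤n (covered h)))) ⟩
        e⁻¹ ^ n * weight h
          ≲⟨ x≤y+x ≤-refl ⟩
        0# + e⁻¹ ^ n * weight h ∎
        where
        0≤eⁿ : 0# ≤ exp 1# ^ n
        0≤eⁿ = ^-nonneg (0≤exp 0≤1) n

-- Choice of the number of links and of the horizon.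

module Horizon {c ℓ₁ ℓ₂} (ℝ : Reals c ℓ₁ ℓ₂)
  (n α β : ℕ) (n>1 : 1 ℕ.< n) (n>0 : 0 ℕ.< n) (β≥1 : 1 ℕ.≤ β)
  (K : ℕ) (e⁴≤K : Reals._≤_ ℝ (Reals.exp ℝ (Reals.fromℕ ℝ 4)) (Reals.fromℕ ℝ K)) where
  open Reals ℝ
  open RealArithmetic ℝ
  open OrderedField ℝ
  open LogarithmicRate ℝ n n>1 n>0
  open SuccessRate ℝ n n>1 n>0 (fromℕ K) e⁴≤K using (rate; 0≤rate; rate*[K+K]≈p)

  -- The value κ = 4K comes from rate = p / 2K and p τ = n: the product κ τ rate is then exactly 2n.
  τ ρ κ : Carrier
  τ = ν * ν / ln⁺ n n>1
  ρ = fromℕ α / ⟦ β ⟧⁺ β≥1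
  κ = (fromℕ K + fromℕ K) + (fromℕ K + fromℕ K)

  private
    0<ℓ : 0# < ℓ
    0<ℓ = proj₂ (ln⁺ n n>1)

    τ*ℓ≈ν*ν : τ * ℓ ≈ ν * ν
    τ*ℓ≈ν*ν = /-cancel (ν * ν) (ln⁺ n n>1)

    0≤τ : 0# ≤ τ
    0≤τ = /-nonneg (ln⁺ n n>1) (*-nonneg 0≤ν 0≤ν)

    0≤κ : 0# ≤ κ
    0≤κ = +-nonneg (+-nonneg (0≤fromℕ K) (0≤fromℕ K)) (+-nonneg (0≤fromℕ K) (0≤fromℕ K))

    0≤ρ : 0# ≤ ρ
    0≤ρ = /-nonneg (⟦ β ⟧⁺ β≥1) (0≤fromℕ α)

    -- Lets τ absorb the additive constants left by rounding.
    1≤τ : 1# ≤ τ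
    1≤τ = *-cancelˡ-≤ 0<ℓ (begin
      ℓ * 1# ≈⟨ *-identityʳ ℓ ⟩
      ℓ      ≲⟨ ≤-trans (x≤y+x 0≤1) 1+ℓ≤ν ⟩
      ν      ≈⟨ *-identityʳ ν ⟨
      ν * 1# ≲⟨ *-monoˡ-≤ 0≤ν (1≤fromℕ n>0) ⟩
      ν * ν  ≈⟨ τ*ℓ≈ν*ν ⟨
      τ * ℓ  ≈⟨ *-comm τ ℓ ⟩
      ℓ * τ  ∎)
      where open ≤-Reasoning

    ν≤p*τ : ν ≤ p * τ
    ν≤p*τ = *-cancelˡ-≤ 0<ν (begin
      ν * ν       ≈⟨ τ*ℓ≈ν*ν ⟨
      τ * ℓ       ≈⟨ *-congˡ p*ν≈ℓ ⟨
      τ * (p * ν) ≈⟨ solve 3 (λ τ p ν → τ :* (p :* ν) := ν :* (p :* τ)) refl τ p ν ⟩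
      ν * (p * τ) ∎)
      where open ≤-Reasoning

    goal : Σ[ m ∈ ℕ ] κ * τ ≤ fromℕ m × fromℕ m ≤ 1# + (1# + κ * τ)
    goal = ceiling (κ * τ) (*-nonneg 0≤κ 0≤τ)

  linkGoal : ℕ
  linkGoal = proj₁ goal

  2ν≤linkGoal*rate : ν + ν ≤ fromℕ linkGoal * rate
  2ν≤linkGoal*rate = begin
    ν + ν                    ≲⟨ +-mono-≤ ν≤p*τ ν≤p*τ ⟩
    p * τ + p * τ            ≈⟨ +-cong (*-congʳ rate*[K+K]≈p) (*-congʳ rate*[K+K]≈p) ⟨
    rate * (fromℕ K + fromℕ K) * τ + rate * (fromℕ K + fromℕ K) * τ
      ≈⟨ solve 3 (λ x k τ → x :* (k :+ k) :* τ :+ x :* (k :+ k) :* τ := ((k :+ k) :+ (k :+ k)) :* τ :* x) refl rate (fromℕ K) τ ⟩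
    κ * τ * rate             ≲⟨ *-monoʳ-≤ 0≤rate (proj₁ (proj₂ goal)) ⟩
    fromℕ linkGoal * rate    ∎
    where open ≤-Reasoning

  private
    instance
      β≢0 : ℕ.NonZero β
      β≢0 = ℕ.>-nonZero β≥1

  -- The share α/β of idle slots per link is rounded up: one more than the integer quotient, so that
  -- `β * gaps` covers `α * linkGoal`.
  gaps horizon : ℕ
  gaps    = suc (α ℕ.* linkGoal ℕ./ β)
  horizon = α ℕ.* n ℕ.+ (linkGoal ℕ.+ gaps)

  α*linkGoal≤β*gaps : α ℕ.* linkGoal ℕ.≤ β ℕ.* gaps
  α*linkGoal≤β*gaps = begin
    α ℕ.* linkGoal
      ≡⟨ m≡m%n+[m/n]*n (α ℕ.* linkGoal) β ⟩
    α ℕ.* linkGoal ℕ.% β ℕ.+ α ℕ.* linkGoal ℕ./ β ℕ.* β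
      ≤⟨ ℕ.+-monoˡ-≤ _ (ℕ.<⇒≤ (m%n<n (α ℕ.* linkGoal) β)) ⟩
    gaps ℕ.* β
      ≡⟨ ℕ.*-comm gaps β ⟩
    β ℕ.* gaps ∎
    where open ℕ.≤-Reasoning

  β*gaps≤α*linkGoal+β : β ℕ.* gaps ℕ.≤ β ℕ.+ α ℕ.* linkGoal
  β*gaps≤α*linkGoal+β = begin
    β ℕ.* gaps                               ≡⟨ ℕ.*-comm β gaps ⟩
    β ℕ.+ α ℕ.* linkGoal ℕ./ β ℕ.* β         ≤⟨ ℕ.+-monoʳ-≤ β (m/n*n≤m (α ℕ.* linkGoal) β) ⟩
    β ℕ.+ α ℕ.* linkGoal                     ∎
    where open ℕ.≤-Reasoning

  private
    B : Carrier
    B = (1# + (1# + κ)) * τ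

    linkGoal≤ : fromℕ linkGoal ≤ B
    linkGoal≤ = begin
      fromℕ linkGoal         ≲⟨ proj₂ (proj₂ goal) ⟩
      1# + (1# + κ * τ)      ≲⟨ +-mono-≤ 1≤τ (+-mono-≤ 1≤τ ≤-refl) ⟩
      τ + (τ + κ * τ)        ≈⟨ solve 2 (λ κ τ → τ :+ (τ :+ κ :* τ) := (con 1 :+ (con 1 :+ κ)) :* τ) refl κ τ ⟩
      B                      ∎
      where open ≤-Reasoning

    gaps≤ : fromℕ gaps ≤ 1# + ρ * fromℕ linkGoal
    gaps≤ = *-cancelˡ-≤ (0<fromℕ β≥1) (begin
      fromℕ β * fromℕ gaps                       ≈⟨ fromℕ-* β gaps ⟨
      fromℕ (β ℕ.* gaps)                         ≲⟨ fromℕ-mono-≤ β*gaps≤α*linkGoal+β ⟩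
      fromℕ (β ℕ.+ α ℕ.* linkGoal)               ≈⟨ trans (fromℕ-+ β _) (+-congˡ (fromℕ-* α linkGoal)) ⟩
      fromℕ β + fromℕ α * fromℕ linkGoal         ≈⟨ +-congˡ (*-congʳ (/-cancel (fromℕ α) (⟦ β ⟧⁺ β≥1))) ⟨
      fromℕ β + ρ * fromℕ β * fromℕ linkGoal     ≈⟨ solve 3 (λ b ρ m → b :+ ρ :* b :* m := b :* (con 1 :+ ρ :* m)) refl (fromℕ β) ρ (fromℕ linkGoal) ⟩
      fromℕ β * (1# + ρ * fromℕ linkGoal)        ∎)
      where open ≤-Reasoning

  -- Rounding gives `linkGoal` at most (2 + 4K) τ and `gaps` at most τ + ρ (2 + 4K) τ; together
  -- these yield the constant 3 + 4K.
  horizon≤ : fromℕ horizon ≤ fromℕ (3 ℕ.+ ((K ℕ.+ K) ℕ.+ (K ℕ.+ K))) * (fromℕ α * ν + (1# + ρ) * τ)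
  horizon≤ = begin
    fromℕ horizon
      ≈⟨ trans (fromℕ-+ (α ℕ.* n) _) (+-cong (fromℕ-* α n) (fromℕ-+ linkGoal gaps)) ⟩
    fromℕ α * ν + (fromℕ linkGoal + fromℕ gaps)
      ≲⟨ +-mono-≤ ≤-refl (+-mono-≤ linkGoal≤
           (≤-trans gaps≤ (+-mono-≤ 1≤τ (*-monoˡ-≤ 0≤ρ linkGoal≤)))) ⟩
    fromℕ α * ν + (B + (τ + ρ * B))
      -- The nonnegative terms added here complete the sum to an exact multiple of the time bound.
      ≲⟨ x≤x+y (+-nonneg (*-nonneg (+-nonneg 0≤1 (+-nonneg 0≤1 0≤κ)) (*-nonneg (0≤fromℕ α) 0≤ν)) (*-nonneg 0≤ρ 0≤τ)) ⟩
    fromℕ α * ν + (B + (τ + ρ * B)) + ((1# + (1# + κ)) * (fromℕ α * ν) + ρ * τ)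
      ≈⟨ solve 4 (λ x κ ρ τ →
           x :+ ((con 1 :+ (con 1 :+ κ)) :* τ :+ (τ :+ ρ :* ((con 1 :+ (con 1 :+ κ)) :* τ))) :+ ((con 1 :+ (con 1 :+ κ)) :* x :+ ρ :* τ)
           := (con 1 :+ (con 1 :+ (con 1 :+ κ))) :* (x :+ (con 1 :+ ρ) :* τ)) refl (fromℕ α * ν) κ ρ τ ⟩
    (1# + (1# + (1# + κ))) * (fromℕ α * ν + (1# + ρ) * τ)
      ≈⟨ *-congʳ (+-congˡ (+-congˡ (+-congˡ (trans (fromℕ-+ (K ℕ.+ K) (K ℕ.+ K)) (+-cong (fromℕ-+ K K) (fromℕ-+ K K)))))) ⟨
    fromℕ (3 ℕ.+ ((K ℕ.+ K) ℕ.+ (K ℕ.+ K))) * (fromℕ α * ν + (1# + ρ) * τ) ∎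
    where open ≤-Reasoning

  -- The horizon is so long that, after the at most n covered nodes have paid their α β each, the
  -- links still owe at least `(α + β) * linkGoal`.
  linkGoal≤links : ∀ {L C} → C ℕ.≤ n →
    β ℕ.* horizon ℕ.≤ α ℕ.* β ℕ.* C ℕ.+ (α ℕ.+ β) ℕ.* L → linkGoal ℕ.≤ L
  linkGoal≤links {L} {C} C≤n βT≤ = ℕ.*-cancelˡ-≤ (α ℕ.+ β) ⦃ ℕ.>-nonZero (ℕ.≤-trans β≥1 (ℕ.m≤n+m β α)) ⦄
    (ℕ.+-cancelˡ-≤ (α ℕ.* β ℕ.* n) _ _ (begin
      α ℕ.* β ℕ.* n ℕ.+ (α ℕ.+ β) ℕ.* linkGoal
        ≡⟨ ℕS.solve 4 (λ a b n m → a ℕS.:* b ℕS.:* n ℕS.:+ (a ℕS.:+ b) ℕS.:* m ℕS.:= a ℕS.:* b ℕS.:* n ℕS.:+ b ℕS.:* m ℕS.:+ a ℕS.:* m) ≡.refl α β n linkGoal ⟩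
      α ℕ.* β ℕ.* n ℕ.+ β ℕ.* linkGoal ℕ.+ α ℕ.* linkGoal
        ≤⟨ ℕ.+-monoʳ-≤ _ α*linkGoal≤β*gaps ⟩
      α ℕ.* β ℕ.* n ℕ.+ β ℕ.* linkGoal ℕ.+ β ℕ.* gaps
        ≡⟨ ℕS.solve 5 (λ a b n m d → a ℕS.:* b ℕS.:* n ℕS.:+ b ℕS.:* m ℕS.:+ b ℕS.:* d ℕS.:= b ℕS.:* (a ℕS.:* n ℕS.:+ (m ℕS.:+ d))) ≡.refl α β n linkGoal gaps ⟩
      β ℕ.* horizon
        ≤⟨ βT≤ ⟩
      α ℕ.* β ℕ.* C ℕ.+ (α ℕ.+ β) ℕ.* L
        ≤⟨ ℕ.+-monoˡ-≤ _ (ℕ.*-monoʳ-≤ (α ℕ.* β) C≤n) ⟩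
      α ℕ.* β ℕ.* n ℕ.+ (α ℕ.+ β) ℕ.* L ∎))
    where
    open ℕ.≤-Reasoning
    module ℕS = ℕSolver.+-*-Solver

-- From e⁻ⁿ to the stated failure probability.

module FailureProbability {c ℓ₁ ℓ₂} (ℝ : Reals c ℓ₁ ℓ₂) where
  open Reals ℝ
  open RealArithmetic ℝ
  open OrderedField ℝ
  open Exponential ℝ

  -- A pure weakening, since (n - 1) / 4 ≤ n.
  e⁻¹^n≤exp[-[n-1]/4] : ∀ n → e⁻¹ ^ n ≤ exp (- (fromℕ (n ℕ.∸ 1) / ⟦ 4 ⟧⁺ (s≤s z≤n)))
  e⁻¹^n≤exp[-[n-1]/4] n = begin
    e⁻¹ ^ n                                    ≈⟨ *-identityʳ _ ⟨
    e⁻¹ ^ n * 1#                               ≈⟨ *-congˡ (trans (*-comm _ _) (exp-inverse v)) ⟨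
    e⁻¹ ^ n * (exp v * exp (- v))              ≲⟨ *-monoˡ-≤ 0≤zⁿ (*-monoʳ-≤ (0≤exp-neg 0≤v) (exp-mono-≤ 0≤v v≤n)) ⟩
    e⁻¹ ^ n * (exp (fromℕ n) * exp (- v))      ≈⟨ *-congˡ (*-congʳ (trans (exp-cong (sym (*-identityʳ _))) (exp-fromℕ n 1#))) ⟩
    e⁻¹ ^ n * (exp 1# ^ n * exp (- v))         ≈⟨ *-assoc _ _ _ ⟨
    e⁻¹ ^ n * exp 1# ^ n * exp (- v)           ≈⟨ *-congʳ (e⁻¹^n*e^n≈1 n) ⟩
    1# * exp (- v)                             ≈⟨ *-identityˡ _ ⟩
    exp (- v)                                  ∎
    where
    open ≤-Reasoning
    v : Carrier
    v = fromℕ (n ℕ.∸ 1) / ⟦ 4 ⟧⁺ (s≤s z≤n)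
    0≤v : 0# ≤ v
    0≤v = /-nonneg (⟦ 4 ⟧⁺ (s≤s z≤n)) (0≤fromℕ (n ℕ.∸ 1))
    0≤zⁿ : 0# ≤ e⁻¹ ^ n
    0≤zⁿ = ^-nonneg 0≤e⁻¹ n
    v≤n : v ≤ fromℕ n
    v≤n = *-cancelˡ-≤ (0<fromℕ {4} (s≤s z≤n)) (begin
      fromℕ 4 * v         ≈⟨ trans (*-comm _ v) (/-cancel _ (⟦ 4 ⟧⁺ (s≤s z≤n))) ⟩
      fromℕ (n ℕ.∸ 1)     ≲⟨ fromℕ-mono-≤ (ℕ.≤-trans (ℕ.m∸n≤m n 1) (ℕ.m≤n*m n 4)) ⟩
      fromℕ (4 ℕ.* n)     ≈⟨ fromℕ-* 4 n ⟩
      fromℕ 4 * fromℕ n   ∎)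

  x≤y+z⇒x-z≤y : ∀ {x y z} → x ≤ y + z → x - z ≤ y
  x≤y+z⇒x-z≤y {x} {y} {z} x≤y+z = +-cancelʳ-≤ z
    (≤-trans (≤-reflexive (trans (+-comm (x - z) z) (x+[y-x]≈y z x))) x≤y+z)

theorem12 :
    ∀ {c ℓ₁ ℓ₂ q} (ℝ : Reals c ℓ₁ ℓ₂) →
    let open Reals ℝ
        open RealArithmetic ℝ
    in
    Σ[ C ∈ ℕ ] ∀ (n α β : ℕ) (n>2 : 2 ℕ.< n) (β≥1 : 1 ℕ.≤ β) →
    let open Network ℝ n
        n>1  = <-trans (n<1+n 1) n>2
        n>0  = <-trans (n<1+n 0) n>1
        p    = proj₁ (ln⁺ n n>1) / ⟦ n ⟧⁺ n>0
        time = fromℕ α * fromℕ n + (1# + fromℕ α / ⟦ β ⟧⁺ β≥1) * (fromℕ n * fromℕ n / ln⁺ n n>1)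
    in
    Σ[ T ∈ ℕ ] fromℕ T ≤ fromℕ C * time ×
    (∀ (r Vmax : ℝ⁺) (A : Adversary r Vmax) (s : Node) {Q : Pred Node q} (Q? : Decidable Q) →
     let open Execution A s
         open Probability p
     in
     (∀ ω → Connected Q α β ω) →
     1# - exp (- (fromℕ (n ℕ.∸ 1) / ⟦ 4 ⟧⁺ (ℕ.s≤s ℕ.z≤n))) ≤ Pr T (solved? Q?))
theorem12 ℝ = 3 ℕ.+ ((K ℕ.+ K) ℕ.+ (K ℕ.+ K)) , λ n α β n>2 β≥1 →
  let n>1 = <-trans (n<1+n 1) n>2
      n>0 = <-trans (n<1+n 0) n>1
      open Horizon ℝ n α β n>1 n>0 β≥1 K e⁴≤K
      open LogarithmicRate ℝ n n>1 n>0 using (p; 0≤p; 0≤y)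
      open SuccessRate ℝ n n>1 n>0 (fromℕ K) e⁴≤K using (rate; 0≤rate; rate-isolates)
  in horizon , horizon≤ , λ r Vmax A s {Q} Q? connectivity →
  let open Network.Execution ℝ n A s
      open Dynamics ℝ n A s
      open Concentration ℝ n p 0≤p 0≤y rate 0≤rate rate-isolates A s
      enough-links : ∀ (h : Network.History ℝ n horizon) → ¬ Solved Q h → linkGoal ℕ.≤ links h
      enough-links h unsolved =
        let ω = extend h
            bound = Progress.time-bound ℝ n A s α β ω (connectivity ω)
                      (unsolved ∘ ≡.subst (Solved _) (prefix-extend h))
        in ≡.subst (λ h → linkGoal ℕ.≤ links h) (prefix-extend h)
             (linkGoal≤links (∣p∣≤n (covered (prefix ω horizon))) bound)
  in x≤y+z⇒x-z≤y (≤-trans (Pr-solved Q? 2ν≤linkGoal*rate enough-links)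
       (+-mono-≤ ≤-refl (e⁻¹^n≤exp[-[n-1]/4] n)))
  where
  open Reals ℝ
  open OrderedField ℝ using (≤-trans; ≤-refl; +-mono-≤; <⇒≤)
  open FailureProbability ℝ
  -- Any natural number above e⁴ serves; the 4 is the excess over ℓ in n u ≤ ℓ + 4. It is fixed
  -- before n, α and β, which makes the constant absolute.
  K : ℕ
  K = proj₁ (archimedean (exp (fromℕ 4)))
  e⁴≤K : exp (fromℕ 4) ≤ fromℕ K
  e⁴≤K = <⇒≤ (proj₂ (archimedean (exp (fromℕ 4))))
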